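{- For every nonzero rational number $r$, the number $\tan r$ is irrational.
   Context: Here $\tan$ is the usual real tangent function, with argument in radians. -}

module Defs where

import Algebra.Definitions.RawSemiring as RawSemiring
open import Data.Integer as ℤ using (+_; -[1+_])
import Data.Integer.Properties as ℤ
open import Data.Nat as ℕ using (ℕ; zero; suc; _!)
import Data.Nat.Properties as ℕ
import Data.Nat.Tactic.RingSolver as ℕ-Solver
open import Data.Product using (∃-syntax; _×_; _,_; proj₁; proj₂)
open import Data.Rational as ℚ
  using (ℚ; mkℚ; 0ℚ; 1ℚ; ½; _+_; _*_; _-_; -_; _/_; 1/_; ∣_∣; _≤_; _<_; *<*)
open import Data.Rational.Properties as ℚ
open import Data.Rational.Solver using (module +-*-Solver)
open import Data.Rational.Unnormalised as ℚᵘ using (mkℚᵘ; *≡*; *≤*)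
import Data.Rational.Unnormalised.Properties as ℚᵘ
open import Data.Sum using (inj₁; inj₂)
open import Relation.Binary.PropositionalEquality
open import Relation.Nullary using (¬_; yes; no; contradiction)

IsCauchy : (ℕ → ℚ) → Set
IsCauchy a = ∀ ε → 0ℚ < ε →
  ∃[ N ] (∀ m n → N ℕ.≤ m → N ℕ.≤ n → ∣ a m - a n ∣ < ε)

record ℝ : Set where
  constructor mkℝ
  field
    seq    : ℕ → ℚ
    cauchy : IsCauchy seq

open ℝ public

infix 4 _≃_

_≃_ : ℝ → ℝ → Set
x ≃ y = ∀ ε → 0ℚ < ε → ∃[ N ] (∀ n → N ℕ.≤ n → ∣ seq x n - seq y n ∣ < ε)

-- For Cauchy sequences this is classically the same as ¬ (x ≃ 0);
-- constructively it is the condition under which x is invertible.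

infix 4 _#0

_#0 : ℝ → Set
x #0 = ∃[ δ ] (0ℚ < δ × ∃[ N ] (∀ n → N ℕ.≤ n → δ ≤ ∣ seq x n ∣))

Σ< : ℕ → (ℕ → ℚ) → ℚ
Σ< zero    f = 0ℚ
Σ< (suc n) f = Σ< n f + f n

infixr 8 _^ℚ_

_^ℚ_ : ℚ → ℕ → ℚ
_^ℚ_ = RawSemiring._^_ ℚ.+-*-rawSemiring

_^_/! : ℚ → ℕ → ℚ
t ^ j /! = t ^ℚ j * ((+ 1 / (j !)) {{j ℕ.!≢0}})

sinTerm cosTerm : ℚ → ℕ → ℚ
sinTerm t k = (- 1ℚ) ^ℚ k * (t ^ (2 ℕ.* k ℕ.+ 1) /!)
cosTerm t k = (- 1ℚ) ^ℚ k * (t ^ (2 ℕ.* k) /!)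

sinPoly cosPoly : ℕ → ℚ → ℚ
sinPoly n t = Σ< n (sinTerm t)
cosPoly n t = Σ< n (cosTerm t)

half+half : ∀ ε → ½ * ε + ½ * ε ≡ ε
half+half ε = trans (sym (*-distribʳ-+ ε ½ ½)) (*-identityˡ ε)

half-sum : ∀ p q ε → p < ½ * ε → q < ½ * ε → p + q < ε
half-sum p q ε p<ε/2 q<ε/2 = subst (p + q <_) (half+half ε)
  (+-mono-< {p} {½ * ε} {q} {½ * ε} p<ε/2 q<ε/2)

0<½* : ∀ ε → 0ℚ < ε → 0ℚ < ½ * ε
0<½* ε 0<ε = subst (_< ½ * ε) (*-zeroʳ ½) (*-monoʳ-<-pos ½ 0<ε)

*-mono-≤-0 : ∀ {a b c d} → 0ℚ ≤ c → a ≤ b → 0ℚ ≤ b → c ≤ d → a * c ≤ b * d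
*-mono-≤-0 {a} {b} {c} {d} 0≤c a≤b 0≤b c≤d =
  ≤-trans (*-monoʳ-≤-nonNeg c {{ℚ.nonNegative 0≤c}} a≤b)
          (*-monoˡ-≤-nonNeg b {{ℚ.nonNegative 0≤b}} c≤d)

0≤* : ∀ {a b} → 0ℚ ≤ a → 0ℚ ≤ b → 0ℚ ≤ a * b
0≤* {a} {b} 0≤a 0≤b =
  subst (_≤ a * b) (*-zeroʳ a) (*-monoˡ-≤-nonNeg a {{ℚ.nonNegative 0≤a}} 0≤b)

∣-∣-comm : ∀ p q → ∣ p - q ∣ ≡ ∣ q - p ∣
∣-∣-comm p q = trans (sym (∣-p∣≡∣p∣ (p - q))) (cong ∣_∣
  (solve 2 (λ p q → :- (p :- q) := q :- p) refl p q))
  where open +-*-Solver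

∣-∣-triangle : ∀ p q r → ∣ p - r ∣ ≤ ∣ p - q ∣ + ∣ q - r ∣
∣-∣-triangle p q r = subst (λ z → ∣ z ∣ ≤ ∣ p - q ∣ + ∣ q - r ∣)
  (solve 3 (λ p q r → (p :- q) :+ (q :- r) := p :- r) refl p q r)
  (∣p+q∣≤∣p∣+∣q∣ (p - q) (q - r))
  where open +-*-Solver

∣p∣≤∣p-q∣+∣q∣ : ∀ p q → ∣ p ∣ ≤ ∣ p - q ∣ + ∣ q ∣
∣p∣≤∣p-q∣+∣q∣ p q = subst (λ z → ∣ z ∣ ≤ ∣ p - q ∣ + ∣ q ∣)
  (solve 2 (λ p q → (p :- q) :+ q := p) refl p q)
  (∣p+q∣≤∣p∣+∣q∣ (p - q) q)
  where open +-*-Solver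

shrink : ∀ B ε → 0ℚ ≤ B → 0ℚ < ε →
         ∃[ δ ] (0ℚ < δ × (∀ p → 0ℚ ≤ p → p < δ → B * p < ε))
shrink B ε 0≤B 0<ε = ε * i , 0<δ , bound
  where
  B+1 = B + 1ℚ
  0<B+1 : 0ℚ < B+1
  0<B+1 = +-mono-≤-< 0≤B (positive⁻¹ 1ℚ)
  instance
    posB+1 : ℚ.Positive B+1
    posB+1 = ℚ.positive 0<B+1
    nzB+1 : ℚ.NonZero B+1
    nzB+1 = pos⇒nonZero B+1
    posε : ℚ.Positive ε
    posε = ℚ.positive 0<ε
  i = 1/ B+1
  0<i : 0ℚ < i
  0<i = positive⁻¹ i {{1/pos⇒pos B+1}}
  0<δ : 0ℚ < ε * i
  0<δ = subst (_< ε * i) (*-zeroʳ ε) (*-monoʳ-<-pos ε 0<i)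
  B≤B+1 : B ≤ B+1
  B≤B+1 = subst (_≤ B+1) (+-identityʳ B) (+-monoʳ-≤ B (nonNegative⁻¹ 1ℚ))
  cancel : B+1 * (ε * i) ≡ ε
  cancel = begin
    B+1 * (ε * i)  ≡⟨ solve 3 (λ b e i → b :* (e :* i) := e :* (b :* i)) refl B+1 ε i ⟩
    ε * (B+1 * i)  ≡⟨ cong (ε *_) (*-inverseʳ B+1) ⟩
    ε * 1ℚ         ≡⟨ *-identityʳ ε ⟩
    ε              ∎
    where open ≡-Reasoning
          open +-*-Solver
  bound : ∀ p → 0ℚ ≤ p → p < ε * i → B * p < ε
  bound p 0≤p p<δ = ≤-<-trans
    (*-monoʳ-≤-nonNeg p {{ℚ.nonNegative 0≤p}} B≤B+1)
    (subst (B+1 * p <_) cancel (*-monoʳ-<-pos B+1 p<δ))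

/-≤ : ∀ a b m n .{{_ : ℕ.NonZero m}} .{{_ : ℕ.NonZero n}} →
      a ℕ.* n ℕ.≤ b ℕ.* m → + a / m ≤ + b / n
/-≤ a b m@(suc m′) n@(suc n′) le = toℚᵘ-cancel-≤
  (ℚᵘ.≤-respʳ-≃ (ℚᵘ.≃-sym (toℚᵘ-fromℚᵘ (mkℚᵘ (+ b) n′)))
  (ℚᵘ.≤-respˡ-≃ (ℚᵘ.≃-sym (toℚᵘ-fromℚᵘ (mkℚᵘ (+ a) m′)))
  (*≤* (subst₂ ℤ._≤_ (ℤ.pos-* a n) (ℤ.pos-* b m) (ℤ.+≤+ le)))))

/-< : ∀ a b m n .{{_ : ℕ.NonZero m}} .{{_ : ℕ.NonZero n}} →
      a ℕ.* n ℕ.< b ℕ.* m → + a / m < + b / n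
/-< a b m@(suc m′) n@(suc n′) lt = toℚᵘ-cancel-<
  (ℚᵘ.<-respʳ-≃ (ℚᵘ.≃-sym (toℚᵘ-fromℚᵘ (mkℚᵘ (+ b) n′)))
  (ℚᵘ.<-respˡ-≃ (ℚᵘ.≃-sym (toℚᵘ-fromℚᵘ (mkℚᵘ (+ a) m′)))
  (ℚᵘ.*<* (subst₂ ℤ._<_ (ℤ.pos-* a n) (ℤ.pos-* b m) (ℤ.+<+ lt)))))

/-* : ∀ a b m n .{{_ : ℕ.NonZero m}} .{{_ : ℕ.NonZero n}} .{{_ : ℕ.NonZero (m ℕ.* n)}} →
      (+ a / m) * (+ b / n) ≡ + (a ℕ.* b) / (m ℕ.* n)
/-* a b m@(suc m′) n@(suc n′) = toℚᵘ-injective (begin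
  ℚ.toℚᵘ ((+ a / m) * (+ b / n))              ≈⟨ toℚᵘ-homo-* (+ a / m) (+ b / n) ⟩
  ℚ.toℚᵘ (+ a / m) ℚᵘ.* ℚ.toℚᵘ (+ b / n)      ≈⟨ ℚᵘ.*-cong (toℚᵘ-fromℚᵘ (mkℚᵘ (+ a) m′)) (toℚᵘ-fromℚᵘ (mkℚᵘ (+ b) n′)) ⟩
  mkℚᵘ (+ a) m′ ℚᵘ.* mkℚᵘ (+ b) n′             ≡⟨ cong (λ z → mkℚᵘ z (ℕ.pred (m ℕ.* n))) (ℤ.pos-* a b) ⟨
  mkℚᵘ (+ (a ℕ.* b)) (ℕ.pred (m ℕ.* n))       ≈⟨ toℚᵘ-fromℚᵘ (mkℚᵘ (+ (a ℕ.* b)) (ℕ.pred (m ℕ.* n))) ⟨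
  ℚ.toℚᵘ (+ (a ℕ.* b) / (m ℕ.* n))            ∎)
  where open ℚᵘ.≃-Reasoning

0≤/ : ∀ a m .{{_ : ℕ.NonZero m}} → 0ℚ ≤ + a / m
0≤/ a m = /-≤ 0 a 1 m ℕ.z≤n

natBound : ∀ p → ∃[ M ] (1 ℕ.≤ M × ∣ p ∣ ≤ + M / 1)
natBound p@(mkℚ n d-1 _) = suc ℤ.∣ n ∣ , ℕ.s≤s ℕ.z≤n ,
  subst (_≤ + suc ℤ.∣ n ∣ / 1) (↥p/↧p≡p ∣ p ∣)
    (/-≤ ℤ.∣ n ∣ (suc ℤ.∣ n ∣) (suc d-1) 1
      (ℕ.≤-trans (ℕ.≤-reflexive (ℕ.*-identityʳ ℤ.∣ n ∣))
      (ℕ.≤-trans (ℕ.n≤1+n ℤ.∣ n ∣) (ℕ.m≤m*n (suc ℤ.∣ n ∣) (suc d-1)))))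

cauchyFrom : ∀ a → (∀ ε → 0ℚ < ε → ∃[ N ] (∀ m → N ℕ.≤ m → ∣ a m - a N ∣ < ε)) →
             IsCauchy a
cauchyFrom a h ε 0<ε with h (½ * ε) (0<½* ε 0<ε)
... | N , close = N , λ m n N≤m N≤n →
  ≤-<-trans (∣-∣-triangle (a m) (a N) (a n))
    (half-sum ∣ a m - a N ∣ ∣ a N - a n ∣ ε (close m N≤m)
      (subst (_< ½ * ε) (∣-∣-comm (a n) (a N)) (close n N≤n)))

bounded : ∀ a → IsCauchy a →
          ∃[ M ] ∃[ N ] (1 ℕ.≤ M × (∀ n → N ℕ.≤ n → ∣ a n ∣ ≤ + M / 1))
bounded a c with c 1ℚ (positive⁻¹ 1ℚ)
... | N , close with natBound (1ℚ + ∣ a N ∣)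
... | M , 1≤M , b = M , N , 1≤M , λ n N≤n → begin
  ∣ a n ∣                  ≤⟨ ∣p∣≤∣p-q∣+∣q∣ (a n) (a N) ⟩
  ∣ a n - a N ∣ + ∣ a N ∣  ≤⟨ +-monoˡ-≤ ∣ a N ∣ (<⇒≤ (close n N N≤n ℕ.≤-refl)) ⟩
  1ℚ + ∣ a N ∣             ≤⟨ p≤∣p∣ (1ℚ + ∣ a N ∣) ⟩
  ∣ 1ℚ + ∣ a N ∣ ∣         ≤⟨ b ⟩
  + M / 1                  ∎
  where
  open ≤-Reasoning
  p≤∣p∣ : ∀ p → p ≤ ∣ p ∣
  p≤∣p∣ p with ≤-total 0ℚ p
  ... | inj₁ 0≤p = ≤-reflexive (sym (0≤p⇒∣p∣≡p 0≤p))
  ... | inj₂ p≤0 = ≤-trans p≤0 (0≤∣p∣ p)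

-- On ∣ t ∣ ≤ M both ∣ tʲ / j! ∣ and its Lipschitz constant are at most
-- G j = (2M)ʲ / j! ≤ 2K / 2ʲ⁺¹ = e (j + 1), where K = (4M)^(4M).

module Taylor (M : ℕ) (1≤M : 1 ℕ.≤ M) where

  ι : ℕ → ℚ
  ι n = + n / 1

  R K : ℕ
  R = 4 ℕ.* M
  K = R ℕ.^ R

  1≤R : 1 ℕ.≤ R
  1≤R = ℕ.≤-trans 1≤M (ℕ.m≤n*m M 4)

  instance
    R≢0 : ℕ.NonZero R
    R≢0 = ℕ.>-nonZero 1≤R
    M≢0 : ℕ.NonZero M
    M≢0 = ℕ.>-nonZero 1≤M

  2^≢0 : ∀ n → ℕ.NonZero (2 ℕ.^ n)
  2^≢0 n = ℕ.m^n≢0 2 n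

  R^j≤K*j! : ∀ j → R ℕ.^ j ℕ.≤ K ℕ.* j !
  R^j≤K*j! zero = ℕ.≤-trans (ℕ.m^n>0 R R) (ℕ.≤-reflexive (sym (ℕ.*-identityʳ K)))
  R^j≤K*j! (suc j) with ℕ.≤-total (suc j) R
  ... | inj₁ 1+j≤R = ℕ.≤-trans (ℕ.^-monoʳ-≤ R 1+j≤R) (ℕ.m≤m*n K (suc j !) {{suc j ℕ.!≢0}})
  ... | inj₂ R≤1+j = ℕ.≤-trans (ℕ.*-mono-≤ R≤1+j (R^j≤K*j! j))
                       (ℕ.≤-reflexive (swap (suc j) K (j !)))
    where
    swap : ∀ a b c → a ℕ.* (b ℕ.* c) ≡ b ℕ.* (a ℕ.* c)
    swap = ℕ-Solver.solve-∀

  ^-distrib-* : ∀ a b j → (a ℕ.* b) ℕ.^ j ≡ a ℕ.^ j ℕ.* b ℕ.^ j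
  ^-distrib-* a b zero    = refl
  ^-distrib-* a b (suc j) = trans (cong (a ℕ.* b ℕ.*_) (^-distrib-* a b j))
    (ℕ.[m*n]*[o*p]≡[m*o]*[n*p] a b (a ℕ.^ j) (b ℕ.^ j))

  e : ℕ → ℚ
  e k = (+ (2 ℕ.* K) / (2 ℕ.^ k)) {{2^≢0 k}}

  G : ℕ → ℚ
  G j = (+ ((2 ℕ.* M) ℕ.^ j) / (j !)) {{j ℕ.!≢0}}

  e-split : ∀ k → e (suc k) + e (suc k) ≡ e k
  e-split k = begin
    e (suc k) + e (suc k)          ≡⟨ cong₂ _+_ e-half e-half ⟩
    ½ * e k + ½ * e k              ≡⟨ half+half (e k) ⟩
    e k                            ∎
    where
    open ≡-Reasoning
    e-half : e (suc k) ≡ ½ * e k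
    e-half = sym (trans (/-* 1 (2 ℕ.* K) 2 (2 ℕ.^ k) {{_}} {{2^≢0 k}} {{2^≢0 (suc k)}})
      (cong (λ z → (+ z / (2 ℕ.^ suc k)) {{2^≢0 (suc k)}}) (ℕ.*-identityˡ (2 ℕ.* K))))

  0≤e : ∀ k → 0ℚ ≤ e k
  0≤e k = 0≤/ (2 ℕ.* K) (2 ℕ.^ k) {{2^≢0 k}}

  n<2^n : ∀ n → n ℕ.< 2 ℕ.^ n
  n<2^n zero    = ℕ.s≤s ℕ.z≤n
  n<2^n (suc n) = ℕ.≤-trans (ℕ.+-mono-≤ (ℕ.m^n>0 2 n) (n<2^n n))
    (ℕ.≤-reflexive (cong (2 ℕ.^ n ℕ.+_) (sym (ℕ.+-identityʳ (2 ℕ.^ n)))))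

  e→0 : ∀ ε → 0ℚ < ε → ∃[ N ] (∀ n → N ℕ.≤ n → e n < ε)
  e→0 ε@(mkℚ (+ zero) d _)      (*<* (ℤ.+<+ ()))
  e→0 ε@(mkℚ -[1+ _ ] d _)      (*<* ())
  e→0 ε@(mkℚ (+ suc p) d _) 0<ε =
    N , λ n N≤n → <-≤-trans (e<1/q n N≤n) 1/q≤ε
    where
    N = (2 ℕ.* K) ℕ.* suc d
    e<1/q : ∀ n → N ℕ.≤ n → e n < + 1 / suc d
    e<1/q n N≤n = /-< (2 ℕ.* K) 1 (2 ℕ.^ n) (suc d) {{2^≢0 n}}
      (subst (N ℕ.<_) (sym (ℕ.*-identityˡ (2 ℕ.^ n))) (ℕ.≤-<-trans N≤n (n<2^n n)))
    1/q≤ε : + 1 / suc d ≤ ε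
    1/q≤ε = subst (+ 1 / suc d ≤_) (↥p/↧p≡p ε)
      (/-≤ 1 (suc p) (suc d) (suc d) (ℕ.*-monoˡ-≤ (suc d) {1} {suc p} (ℕ.s≤s ℕ.z≤n)))

  G≤e : ∀ {j k} → k ℕ.≤ j → G j ≤ e (suc k)
  G≤e {j} {k} k≤j = /-≤ ((2 ℕ.* M) ℕ.^ j) (2 ℕ.* K) (j !) (2 ℕ.^ suc k) {{j ℕ.!≢0}} {{2^≢0 (suc k)}} (begin
    (2 ℕ.* M) ℕ.^ j ℕ.* (2 ℕ.* 2 ℕ.^ k)  ≤⟨ ℕ.*-monoʳ-≤ ((2 ℕ.* M) ℕ.^ j) (ℕ.*-monoʳ-≤ 2 (ℕ.^-monoʳ-≤ 2 k≤j)) ⟩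
    (2 ℕ.* M) ℕ.^ j ℕ.* (2 ℕ.* 2 ℕ.^ j)  ≡⟨ pull ((2 ℕ.* M) ℕ.^ j) (2 ℕ.^ j) ⟩
    2 ℕ.* (2 ℕ.^ j ℕ.* (2 ℕ.* M) ℕ.^ j)  ≡⟨ cong (2 ℕ.*_) (^-distrib-* 2 (2 ℕ.* M) j) ⟨
    2 ℕ.* (2 ℕ.* (2 ℕ.* M)) ℕ.^ j        ≡⟨ cong (λ z → 2 ℕ.* z ℕ.^ j) (ℕ.*-assoc 2 2 M) ⟨
    2 ℕ.* R ℕ.^ j                        ≤⟨ ℕ.*-monoʳ-≤ 2 (R^j≤K*j! j) ⟩
    2 ℕ.* (K ℕ.* j !)                    ≡⟨ ℕ.*-assoc 2 K (j !) ⟨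
    2 ℕ.* K ℕ.* j !                      ∎)
    where
    open ℕ.≤-Reasoning
    pull : ∀ a b → a ℕ.* (2 ℕ.* b) ≡ 2 ℕ.* (b ℕ.* a)
    pull = ℕ-Solver.solve-∀

  1/! : ℕ → ℚ
  1/! j = (+ 1 / (j !)) {{j ℕ.!≢0}}

  Small : ℚ → Set
  Small t = ∣ t ∣ ≤ ι M

  ∣*∣ : ∀ p q → ∣ p * q ∣ ≡ ∣ p ∣ * ∣ q ∣
  ∣*∣ = ∣p*q∣≡∣p∣*∣q∣

  ι-* : ∀ a b → ι a * ι b ≡ ι (a ℕ.* b)
  ι-* a b = /-* a b 1 1

  ι-mono : ∀ {a b} → a ℕ.≤ b → ι a ≤ ι b
  ι-mono {a} {b} a≤b = /-≤ a b 1 1 (ℕ.*-monoˡ-≤ 1 a≤b)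

  0≤ι : ∀ a → 0ℚ ≤ ι a
  0≤ι a = 0≤/ a 1

  G≡ : ∀ j → ι ((2 ℕ.* M) ℕ.^ j) * 1/! j ≡ G j
  G≡ j = trans (/-* ((2 ℕ.* M) ℕ.^ j) 1 1 (j !) {{_}} {{j ℕ.!≢0}} {{1*≢0}})
    (/-cong {{1*≢0}} {{j ℕ.!≢0}} (cong +_ (ℕ.*-identityʳ ((2 ℕ.* M) ℕ.^ j))) (ℕ.*-identityˡ (j !)))
    where
    1*≢0 = ℕ.m*n≢0 1 (j !) {{_}} {{j ℕ.!≢0}}

  ^-bound : ∀ {t} → Small t → ∀ j → ∣ t ^ℚ j ∣ ≤ ι (M ℕ.^ j)
  ^-bound s zero = ≤-refl
  ^-bound {t} s (suc j) = begin
    ∣ t * t ^ℚ j ∣        ≡⟨ ∣*∣ t (t ^ℚ j) ⟩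
    ∣ t ∣ * ∣ t ^ℚ j ∣    ≤⟨ *-mono-≤-0 (0≤∣p∣ (t ^ℚ j)) s (0≤ι M) (^-bound s j) ⟩
    ι M * ι (M ℕ.^ j)     ≡⟨ ι-* M (M ℕ.^ j) ⟩
    ι (M ℕ.^ suc j)       ∎
    where open ≤-Reasoning

  M^≤2M^ : ∀ j → M ℕ.^ j ℕ.≤ (2 ℕ.* M) ℕ.^ j
  M^≤2M^ j = ℕ.^-monoˡ-≤ j (ℕ.m≤n*m M 2)

  ^-lipschitz : ∀ {s t} → Small s → Small t → ∀ j →
                ∣ s ^ℚ j - t ^ℚ j ∣ ≤ ι ((2 ℕ.* M) ℕ.^ j) * ∣ s - t ∣
  ^-lipschitz {s} {t} _ _ zero = 0≤* (0≤ι 1) (0≤∣p∣ (s - t))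
  ^-lipschitz {s} {t} bs bt (suc j) = begin
    ∣ s * s ^ℚ j - t * t ^ℚ j ∣
      ≡⟨ cong ∣_∣ (solve 4 (λ s t a b →
           s :* a :- t :* b := s :* (a :- b) :+ b :* (s :- t)) refl s t (s ^ℚ j) (t ^ℚ j)) ⟩
    ∣ s * (s ^ℚ j - t ^ℚ j) + t ^ℚ j * (s - t) ∣
      ≤⟨ ∣p+q∣≤∣p∣+∣q∣ (s * (s ^ℚ j - t ^ℚ j)) (t ^ℚ j * (s - t)) ⟩
    ∣ s * (s ^ℚ j - t ^ℚ j) ∣ + ∣ t ^ℚ j * (s - t) ∣
      ≡⟨ cong₂ _+_ (∣*∣ s (s ^ℚ j - t ^ℚ j)) (∣*∣ (t ^ℚ j) (s - t)) ⟩
    ∣ s ∣ * ∣ s ^ℚ j - t ^ℚ j ∣ + ∣ t ^ℚ j ∣ * d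
      ≤⟨ +-mono-≤
           (*-mono-≤-0 (0≤∣p∣ (s ^ℚ j - t ^ℚ j)) bs (0≤ι M) (^-lipschitz bs bt j))
           (*-monoʳ-≤-nonNeg d {{∣-∣-nonNeg (s - t)}} (^-bound bt j)) ⟩
    ι M * (ι P * d) + ι (M ℕ.^ j) * d
      ≤⟨ +-monoʳ-≤ (ι M * (ι P * d))
           (*-monoʳ-≤-nonNeg d {{∣-∣-nonNeg (s - t)}} (ι-mono M^≤MP)) ⟩
    ι M * (ι P * d) + ι (M ℕ.* P) * d
      ≡⟨ cong (λ z → ι M * (ι P * d) + z * d) (ι-* M P) ⟨
    ι M * (ι P * d) + ι M * ι P * d
      ≡⟨ solve 3 (λ m p d → m :* (p :* d) :+ m :* p :* d
                   := con (ι 2) :* (m :* p) :* d) refl (ι M) (ι P) d ⟩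
    ι 2 * (ι M * ι P) * d
      ≡⟨ cong (_* d) (trans (cong (ι 2 *_) (ι-* M P)) (ι-* 2 (M ℕ.* P))) ⟩
    ι (2 ℕ.* (M ℕ.* P)) * d
      ≡⟨ cong (λ z → ι z * d) (ℕ.*-assoc 2 M P) ⟨
    ι ((2 ℕ.* M) ℕ.^ suc j) * d
      ∎
    where
    open ≤-Reasoning
    open +-*-Solver
    d = ∣ s - t ∣
    P = (2 ℕ.* M) ℕ.^ j
    M^≤MP : M ℕ.^ j ℕ.≤ M ℕ.* P
    M^≤MP = ℕ.≤-trans (M^≤2M^ j) (ℕ.m≤n*m P M)

  0≤1/! : ∀ j → 0ℚ ≤ 1/! j
  0≤1/! j = 0≤/ 1 (j !) {{j ℕ.!≢0}}

  mono-bound : ∀ {t} → Small t → ∀ j → ∣ t ^ j /! ∣ ≤ G j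
  mono-bound {t} b j = begin
    ∣ t ^ℚ j * 1/! j ∣                ≡⟨ ∣*∣ (t ^ℚ j) (1/! j) ⟩
    ∣ t ^ℚ j ∣ * ∣ 1/! j ∣            ≡⟨ cong (λ z → ∣ t ^ℚ j ∣ * z) (0≤p⇒∣p∣≡p (0≤1/! j)) ⟩
    ∣ t ^ℚ j ∣ * 1/! j                ≤⟨ *-monoʳ-≤-nonNeg (1/! j) {{ℚ.nonNegative (0≤1/! j)}}
                                           (≤-trans (^-bound b j) (ι-mono (M^≤2M^ j))) ⟩
    ι ((2 ℕ.* M) ℕ.^ j) * 1/! j       ≡⟨ G≡ j ⟩
    G j                               ∎
    where open ≤-Reasoning

  mono-lipschitz : ∀ {s t} → Small s → Small t → ∀ j →
                   ∣ (s ^ j /!) - (t ^ j /!) ∣ ≤ G j * ∣ s - t ∣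
  mono-lipschitz {s} {t} bs bt j = begin
    ∣ s ^ℚ j * f - t ^ℚ j * f ∣
      ≡⟨ cong ∣_∣ (solve 3 (λ a b f → a :* f :- b :* f := (a :- b) :* f) refl (s ^ℚ j) (t ^ℚ j) f) ⟩
    ∣ (s ^ℚ j - t ^ℚ j) * f ∣
      ≡⟨ ∣*∣ (s ^ℚ j - t ^ℚ j) f ⟩
    ∣ s ^ℚ j - t ^ℚ j ∣ * ∣ f ∣
      ≡⟨ cong (λ z → ∣ s ^ℚ j - t ^ℚ j ∣ * z) (0≤p⇒∣p∣≡p (0≤1/! j)) ⟩
    ∣ s ^ℚ j - t ^ℚ j ∣ * f
      ≤⟨ *-monoʳ-≤-nonNeg f {{ℚ.nonNegative (0≤1/! j)}} (^-lipschitz bs bt j) ⟩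
    ι P * d * f
      ≡⟨ solve 3 (λ p d f → p :* d :* f := p :* f :* d) refl (ι P) d f ⟩
    ι P * f * d
      ≡⟨ cong (_* d) (G≡ j) ⟩
    G j * d
      ∎
    where
    open ≤-Reasoning
    open +-*-Solver
    f = 1/! j
    d = ∣ s - t ∣
    P = (2 ℕ.* M) ℕ.^ j

  ∣±1∣ : ∀ k → ∣ (- 1ℚ) ^ℚ k ∣ ≡ 1ℚ
  ∣±1∣ zero    = refl
  ∣±1∣ (suc k) = trans (∣*∣ (- 1ℚ) ((- 1ℚ) ^ℚ k))
    (trans (cong (λ z → ∣ - 1ℚ ∣ * z) (∣±1∣ k)) refl)

  module Series (index : ℕ → ℕ) (k≤index : ∀ k → k ℕ.≤ index k) where

    term : ℚ → ℕ → ℚ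
    term t k = (- 1ℚ) ^ℚ k * (t ^ index k /!)

    ∣±∣ : ∀ k p → ∣ (- 1ℚ) ^ℚ k * p ∣ ≡ ∣ p ∣
    ∣±∣ k p = trans (∣*∣ ((- 1ℚ) ^ℚ k) p)
      (trans (cong (λ z → z * ∣ p ∣) (∣±1∣ k)) (*-identityˡ ∣ p ∣))

    term-bound : ∀ {t} → Small t → ∀ k → ∣ term t k ∣ ≤ e (suc k)
    term-bound {t} b k = ≤-trans (≤-reflexive (∣±∣ k (t ^ index k /!)))
      (≤-trans (mono-bound b (index k)) (G≤e (k≤index k)))

    term-lipschitz : ∀ {s t} → Small s → Small t → ∀ k →
                     ∣ term s k - term t k ∣ ≤ e (suc k) * ∣ s - t ∣
    term-lipschitz {s} {t} bs bt k = begin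
      ∣ σ * a - σ * b ∣        ≡⟨ cong ∣_∣ (solve 3 (λ σ a b → σ :* a :- σ :* b := σ :* (a :- b)) refl σ a b) ⟩
      ∣ σ * (a - b) ∣          ≡⟨ ∣±∣ k (a - b) ⟩
      ∣ a - b ∣                ≤⟨ mono-lipschitz bs bt (index k) ⟩
      G (index k) * ∣ s - t ∣  ≤⟨ *-monoʳ-≤-nonNeg ∣ s - t ∣ {{∣-∣-nonNeg (s - t)}} (G≤e (k≤index k)) ⟩
      e (suc k) * ∣ s - t ∣    ∎
      where
      open ≤-Reasoning
      open +-*-Solver
      σ = (- 1ℚ) ^ℚ k
      a = s ^ index k /!
      b = t ^ index k /!

    S : ℕ → ℚ → ℚ
    S n t = Σ< n (term t)

    tail : ∀ {t} → Small t → ∀ n d → ∣ S (d ℕ.+ n) t - S n t ∣ + e (d ℕ.+ n) ≤ e n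
    tail {t} b n zero = ≤-reflexive (trans
      (cong (λ z → ∣ z ∣ + e n) (+-inverseʳ (S n t))) (+-identityˡ (e n)))
    tail {t} b n (suc d) = begin
      ∣ A + u - B ∣ + e (suc m)
        ≡⟨ cong (λ z → ∣ z ∣ + e (suc m))
             (solve 3 (λ A u B → A :+ u :- B := (A :- B) :+ u) refl A u B) ⟩
      ∣ (A - B) + u ∣ + e (suc m)
        ≤⟨ +-monoˡ-≤ (e (suc m)) (∣p+q∣≤∣p∣+∣q∣ (A - B) u) ⟩
      ∣ A - B ∣ + ∣ u ∣ + e (suc m)
        ≤⟨ +-monoˡ-≤ (e (suc m)) (+-monoʳ-≤ ∣ A - B ∣ (term-bound b m)) ⟩
      ∣ A - B ∣ + e (suc m) + e (suc m)
        ≡⟨ trans (+-assoc ∣ A - B ∣ (e (suc m)) (e (suc m))) (cong (λ z → ∣ A - B ∣ + z) (e-split m)) ⟩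
      ∣ A - B ∣ + e m
        ≤⟨ tail b n d ⟩
      e n
        ∎
      where
      open ≤-Reasoning
      open +-*-Solver
      m = d ℕ.+ n
      A = S m t
      B = S n t
      u = term t m

    tail′ : ∀ {t} → Small t → ∀ {m n} → n ℕ.≤ m → ∣ S m t - S n t ∣ ≤ e n
    tail′ {t} b {m} {n} n≤m = begin
      ∣ S m t - S n t ∣               ≡⟨ cong (λ z → ∣ S z t - S n t ∣) (ℕ.m∸n+n≡m n≤m) ⟨
      ∣ S m′ t - S n t ∣              ≡⟨ +-identityʳ ∣ S m′ t - S n t ∣ ⟨
      ∣ S m′ t - S n t ∣ + 0ℚ         ≤⟨ +-monoʳ-≤ ∣ S m′ t - S n t ∣ (0≤e m′) ⟩
      ∣ S m′ t - S n t ∣ + e m′       ≤⟨ tail b n (m ℕ.∸ n) ⟩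
      e n                             ∎
      where
      open ≤-Reasoning
      m′ = m ℕ.∸ n ℕ.+ n

    lipschitz+ : ∀ {s t} → Small s → Small t → ∀ n →
                 ∣ S n s - S n t ∣ + e n * ∣ s - t ∣ ≤ e 0 * ∣ s - t ∣
    lipschitz+ {s} {t} bs bt zero = ≤-reflexive (+-identityˡ (e 0 * ∣ s - t ∣))
    lipschitz+ {s} {t} bs bt (suc n) = begin
      ∣ A + u - (B + v) ∣ + f * d
        ≡⟨ cong (λ z → ∣ z ∣ + f * d)
             (solve 4 (λ A u B v → A :+ u :- (B :+ v) := (A :- B) :+ (u :- v)) refl A u B v) ⟩
      ∣ (A - B) + (u - v) ∣ + f * d
        ≤⟨ +-monoˡ-≤ (f * d) (∣p+q∣≤∣p∣+∣q∣ (A - B) (u - v)) ⟩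
      ∣ A - B ∣ + ∣ u - v ∣ + f * d
        ≤⟨ +-monoˡ-≤ (f * d) (+-monoʳ-≤ ∣ A - B ∣ (term-lipschitz bs bt n)) ⟩
      ∣ A - B ∣ + f * d + f * d
        ≡⟨ solve 3 (λ D f d → D :+ f :* d :+ f :* d := D :+ (f :+ f) :* d) refl ∣ A - B ∣ f d ⟩
      ∣ A - B ∣ + (f + f) * d
        ≡⟨ cong (λ z → ∣ A - B ∣ + z * d) (e-split n) ⟩
      ∣ A - B ∣ + e n * d
        ≤⟨ lipschitz+ bs bt n ⟩
      e 0 * d
        ∎
      where
      open ≤-Reasoning
      open +-*-Solver
      A = S n s
      B = S n t
      u = term s n
      v = term t n
      d = ∣ s - t ∣
      f = e (suc n)

    lipschitz : ∀ {s t} → Small s → Small t → ∀ n →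
                ∣ S n s - S n t ∣ ≤ e 0 * ∣ s - t ∣
    lipschitz {s} {t} bs bt n = begin
      ∣ S n s - S n t ∣                    ≡⟨ +-identityʳ ∣ S n s - S n t ∣ ⟨
      ∣ S n s - S n t ∣ + 0ℚ               ≤⟨ +-monoʳ-≤ ∣ S n s - S n t ∣ (0≤* (0≤e n) (0≤∣p∣ (s - t))) ⟩
      ∣ S n s - S n t ∣ + e n * ∣ s - t ∣  ≤⟨ lipschitz+ bs bt n ⟩
      e 0 * ∣ s - t ∣                      ∎
      where open ≤-Reasoning

diagonal : ∀ (S : ℕ → ℚ → ℚ) (e : ℕ → ℚ) (a : ℕ → ℚ) (N₀ : ℕ) → IsCauchy a →
  0ℚ ≤ e 0 →
  (∀ ε → 0ℚ < ε → ∃[ N ] (∀ n → N ℕ.≤ n → e n < ε)) →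
  (∀ i m n → N₀ ℕ.≤ i → n ℕ.≤ m → ∣ S m (a i) - S n (a i) ∣ ≤ e n) →
  (∀ i j n → N₀ ℕ.≤ i → N₀ ℕ.≤ j → ∣ S n (a i) - S n (a j) ∣ ≤ e 0 * ∣ a i - a j ∣) →
  IsCauchy (λ n → S n (a n))
diagonal S e a N₀ c 0≤e₀ e→0 tail lipschitz = cauchyFrom (λ n → S n (a n)) close
  where
  Close : ℚ → Set
  Close ε = ∃[ N ] (∀ m → N ℕ.≤ m → ∣ S m (a m) - S N (a N) ∣ < ε)

  combine : ∀ ε δ → (∀ p → 0ℚ ≤ p → p < δ → e 0 * p < ½ * ε) →
            ∃[ N ] (∀ n → N ℕ.≤ n → e n < ½ * ε) →
            ∃[ N ] (∀ m n → N ℕ.≤ m → N ℕ.≤ n → ∣ a m - a n ∣ < δ) →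
            Close ε
  combine ε δ shr (N₁ , e<ε/2) (N₂ , close-a) = N , λ m N≤m →
    ≤-<-trans (∣-∣-triangle (S m (a m)) (S N (a m)) (S N (a N)))
      (half-sum ∣ S m (a m) - S N (a m) ∣ ∣ S N (a m) - S N (a N) ∣ ε
        (≤-<-trans (tail m m N (ℕ.≤-trans N₀≤N N≤m) N≤m) (e<ε/2 N N₁≤N))
        (≤-<-trans (lipschitz m N N (ℕ.≤-trans N₀≤N N≤m) N₀≤N)
          (shr ∣ a m - a N ∣ (0≤∣p∣ (a m - a N))
            (close-a m N (ℕ.≤-trans N₂≤N N≤m) N₂≤N))))
    where
    N = N₀ ℕ.+ (N₁ ℕ.+ N₂)
    N₀≤N : N₀ ℕ.≤ N
    N₀≤N = ℕ.m≤m+n N₀ (N₁ ℕ.+ N₂)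
    N₁≤N : N₁ ℕ.≤ N
    N₁≤N = ℕ.≤-trans (ℕ.m≤m+n N₁ N₂) (ℕ.m≤n+m (N₁ ℕ.+ N₂) N₀)
    N₂≤N : N₂ ℕ.≤ N
    N₂≤N = ℕ.≤-trans (ℕ.m≤n+m N₂ N₁) (ℕ.m≤n+m (N₁ ℕ.+ N₂) N₀)

  close : ∀ ε → 0ℚ < ε → Close ε
  close ε 0<ε = choose (shrink (e 0) (½ * ε) 0≤e₀ 0<ε/2)
    where
    0<ε/2 : 0ℚ < ½ * ε
    0<ε/2 = 0<½* ε 0<ε
    choose : ∃[ δ ] (0ℚ < δ × (∀ p → 0ℚ ≤ p → p < δ → e 0 * p < ½ * ε)) → Close ε
    choose (δ , 0<δ , shr) = combine ε δ shr (e→0 (½ * ε) 0<ε/2) (c δ 0<δ)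

diagonal-cauchy : ∀ (index : ℕ → ℕ) → (∀ k → k ℕ.≤ index k) →
  ∀ a → IsCauchy a →
  IsCauchy (λ n → Σ< n (λ k → (- 1ℚ) ^ℚ k * (a n ^ index k /!)))
diagonal-cauchy index k≤index a c = choose (bounded a c)
  where
  Goal : Set
  Goal = IsCauchy (λ n → Σ< n (λ k → (- 1ℚ) ^ℚ k * (a n ^ index k /!)))
  choose : ∃[ M ] ∃[ N ] (1 ℕ.≤ M × (∀ n → N ℕ.≤ n → ∣ a n ∣ ≤ + M / 1)) → Goal
  choose (M , N₀ , 1≤M , small) = diagonal S e a N₀ c (0≤e 0) e→0
    (λ i m n N₀≤i n≤m → tail′ {a i} (small i N₀≤i) {m} {n} n≤m)
    (λ i j n N₀≤i N₀≤j → lipschitz {a i} {a j} (small i N₀≤i) (small j N₀≤j) n)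
    where
    open Taylor M 1≤M
    open Series index k≤index

*-difference : ∀ p q r s A B → ∣ p ∣ ≤ A → ∣ s ∣ ≤ B →
  ∣ p * q - r * s ∣ ≤ A * ∣ q - s ∣ + B * ∣ p - r ∣
*-difference p q r s A B p≤A s≤B = begin
  ∣ p * q - r * s ∣
    ≡⟨ cong ∣_∣ (solve 4 (λ p q r s →
         p :* q :- r :* s := p :* (q :- s) :+ s :* (p :- r)) refl p q r s) ⟩
  ∣ p * (q - s) + s * (p - r) ∣
    ≤⟨ ∣p+q∣≤∣p∣+∣q∣ (p * (q - s)) (s * (p - r)) ⟩
  ∣ p * (q - s) ∣ + ∣ s * (p - r) ∣
    ≡⟨ cong₂ _+_ (∣p*q∣≡∣p∣*∣q∣ p (q - s)) (∣p*q∣≡∣p∣*∣q∣ s (p - r)) ⟩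
  ∣ p ∣ * ∣ q - s ∣ + ∣ s ∣ * ∣ p - r ∣
    ≤⟨ +-mono-≤ {∣ p ∣ * ∣ q - s ∣} {A * ∣ q - s ∣} {∣ s ∣ * ∣ p - r ∣} {B * ∣ p - r ∣}
         (*-monoʳ-≤-nonNeg ∣ q - s ∣ {{∣-∣-nonNeg (q - s)}} {∣ p ∣} {A} p≤A)
         (*-monoʳ-≤-nonNeg ∣ p - r ∣ {{∣-∣-nonNeg (p - r)}} {∣ s ∣} {B} s≤B) ⟩
  A * ∣ q - s ∣ + B * ∣ p - r ∣ ∎
  where
  open ≤-Reasoning
  open +-*-Solver

module Product (a b : ℕ → ℚ) (ca : IsCauchy a) (cb : IsCauchy b) where

  Bound : (ℕ → ℚ) → ℚ → Set
  Bound c C = ∃[ N ] (∀ n → N ℕ.≤ n → ∣ c n ∣ ≤ C)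

  Within : (ℕ → ℚ) → ℚ → ℚ → Set
  Within c C ε = ∃[ N ] (∀ m n → N ℕ.≤ m → N ℕ.≤ n → C * ∣ c m - c n ∣ < ε)

  combine : ∀ A B ε → Bound a A → Bound b B →
    Within b A (½ * ε) → Within a B (½ * ε) →
    ∃[ N ] (∀ m n → N ℕ.≤ m → N ℕ.≤ n → ∣ a m * b m - a n * b n ∣ < ε)
  combine A B ε (N₀ , ba) (N₁ , bb) (N₂ , close-b) (N₃ , close-a) = N , λ m n N≤m N≤n →
    ≤-<-trans
      (*-difference (a m) (b m) (a n) (b n) A B
        (ba m (ℕ.≤-trans N₀≤N N≤m)) (bb n (ℕ.≤-trans N₁≤N N≤n)))
      (half-sum (A * ∣ b m - b n ∣) (B * ∣ a m - a n ∣) ε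
        (close-b m n (ℕ.≤-trans N₂≤N N≤m) (ℕ.≤-trans N₂≤N N≤n))
        (close-a m n (ℕ.≤-trans N₃≤N N≤m) (ℕ.≤-trans N₃≤N N≤n)))
    where
    N = (N₀ ℕ.+ N₁) ℕ.+ (N₂ ℕ.+ N₃)
    N₀≤N : N₀ ℕ.≤ N
    N₀≤N = ℕ.≤-trans (ℕ.m≤m+n N₀ N₁) (ℕ.m≤m+n (N₀ ℕ.+ N₁) (N₂ ℕ.+ N₃))
    N₁≤N : N₁ ℕ.≤ N
    N₁≤N = ℕ.≤-trans (ℕ.m≤n+m N₁ N₀) (ℕ.m≤m+n (N₀ ℕ.+ N₁) (N₂ ℕ.+ N₃))
    N₂≤N : N₂ ℕ.≤ N
    N₂≤N = ℕ.≤-trans (ℕ.m≤m+n N₂ N₃) (ℕ.m≤n+m (N₂ ℕ.+ N₃) (N₀ ℕ.+ N₁))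
    N₃≤N : N₃ ℕ.≤ N
    N₃≤N = ℕ.≤-trans (ℕ.m≤n+m N₃ N₂) (ℕ.m≤n+m (N₂ ℕ.+ N₃) (N₀ ℕ.+ N₁))

  within : ∀ c → IsCauchy c → ∀ C → 0ℚ ≤ C → ∀ ε → 0ℚ < ε → Within c C ε
  within c cc C 0≤C ε 0<ε = choose (shrink C ε 0≤C 0<ε)
    where
    choose : ∃[ δ ] (0ℚ < δ × (∀ p → 0ℚ ≤ p → p < δ → C * p < ε)) → Within c C ε
    choose (δ , 0<δ , shr) = restrict (cc δ 0<δ)
      where
      restrict : ∃[ N ] (∀ m n → N ℕ.≤ m → N ℕ.≤ n → ∣ c m - c n ∣ < δ) → Within c C ε
      restrict (N , close) = N , λ m n N≤m N≤n →
        shr ∣ c m - c n ∣ (0≤∣p∣ (c m - c n)) (close m n N≤m N≤n)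

  *-cauchy : IsCauchy (λ n → a n * b n)
  *-cauchy ε 0<ε = choose (bounded a ca) (bounded b cb)
    where
    choose : ∃[ A ] ∃[ N ] (1 ℕ.≤ A × (∀ n → N ℕ.≤ n → ∣ a n ∣ ≤ + A / 1)) →
             ∃[ B ] ∃[ N ] (1 ℕ.≤ B × (∀ n → N ℕ.≤ n → ∣ b n ∣ ≤ + B / 1)) →
             ∃[ N ] (∀ m n → N ℕ.≤ m → N ℕ.≤ n → ∣ a m * b m - a n * b n ∣ < ε)
    choose (A , N₀ , _ , ba) (B , N₁ , _ , bb) =
      combine (+ A / 1) (+ B / 1) ε (N₀ , ba) (N₁ , bb)
        (within b cb (+ A / 1) (0≤/ A 1) (½ * ε) (0<½* ε 0<ε))
        (within a ca (+ B / 1) (0≤/ B 1) (½ * ε) (0<½* ε 0<ε))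

open Product using (*-cauchy)

-- The junk value at 0 affects only finitely many entries of a sequence that
-- is bounded away from 0.

recip : ℚ → ℚ
recip p with p ℚ.≟ 0ℚ
... | yes _   = 0ℚ
... | no p≢0 = (1/ p) {{ℚ.≢-nonZero p≢0}}

recip-inverse : ∀ p → p ≢ 0ℚ → p * recip p ≡ 1ℚ
recip-inverse p p≢0 with p ℚ.≟ 0ℚ
... | yes p≡0 = contradiction p≡0 p≢0
... | no p≢0′ = *-inverseʳ p {{ℚ.≢-nonZero p≢0′}}

recip-cauchy : ∀ x → x #0 → IsCauchy (λ n → recip (seq x n))
recip-cauchy x (δ , 0<δ , N₀ , apart) ε 0<ε = N , close
  where
  a = seq x
  instance
    posδ : ℚ.Positive δ
    posδ = ℚ.positive 0<δ
  0≤δ : 0ℚ ≤ δ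
  0≤δ = <⇒≤ 0<δ
  0<δδ : 0ℚ < δ * δ
  0<δδ = subst (_< δ * δ) (*-zeroʳ δ) (*-monoʳ-<-pos δ 0<δ)
  0<δδε : 0ℚ < (δ * δ) * ε
  0<δδε = subst (_< (δ * δ) * ε) (*-zeroʳ (δ * δ))
    (*-monoʳ-<-pos (δ * δ) {{ℚ.positive 0<δδ}} 0<ε)
  N₁ = proj₁ (cauchy x ((δ * δ) * ε) 0<δδε)
  close-a = proj₂ (cauchy x ((δ * δ) * ε) 0<δδε)
  N = N₀ ℕ.+ N₁
  inv : ∀ n → N ℕ.≤ n → a n * recip (a n) ≡ 1ℚ
  inv n N≤n = recip-inverse (a n) λ a≡0 →
    <-irrefl refl (<-≤-trans 0<δ (subst (λ z → δ ≤ ∣ z ∣) a≡0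
      (apart n (ℕ.≤-trans (ℕ.m≤m+n N₀ N₁) N≤n))))
  close : ∀ m n → N ℕ.≤ m → N ℕ.≤ n → ∣ recip (a m) - recip (a n) ∣ < ε
  close m n N≤m N≤n = *-cancelˡ-<-nonNeg (δ * δ)
    {{ℚ.nonNegative (<⇒≤ 0<δδ)}} (begin-strict
    (δ * δ) * ∣ u - v ∣
      ≤⟨ *-monoʳ-≤-nonNeg ∣ u - v ∣ {{∣-∣-nonNeg (u - v)}}
           (*-mono-≤-0 {δ} {∣ p ∣} {δ} {∣ q ∣} 0≤δ (apart m N₀≤m) (0≤∣p∣ p) (apart n N₀≤n)) ⟩
    (∣ p ∣ * ∣ q ∣) * ∣ u - v ∣
      ≡⟨ cong (λ z → z * ∣ u - v ∣) (∣p*q∣≡∣p∣*∣q∣ p q) ⟨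
    ∣ p * q ∣ * ∣ u - v ∣
      ≡⟨ ∣p*q∣≡∣p∣*∣q∣ (p * q) (u - v) ⟨
    ∣ (p * q) * (u - v) ∣
      ≡⟨ cong ∣_∣ (solve 4 (λ p q u v →
           (p :* q) :* (u :- v) := q :* (p :* u) :- p :* (q :* v)) refl p q u v) ⟩
    ∣ q * (p * u) - p * (q * v) ∣
      ≡⟨ cong₂ (λ y z → ∣ q * y - p * z ∣) (inv m N≤m) (inv n N≤n) ⟩
    ∣ q * 1ℚ - p * 1ℚ ∣
      ≡⟨ cong₂ (λ y z → ∣ y - z ∣) (*-identityʳ q) (*-identityʳ p) ⟩
    ∣ q - p ∣
      <⟨ close-a n m (ℕ.≤-trans (ℕ.m≤n+m N₁ N₀) N≤n) (ℕ.≤-trans (ℕ.m≤n+m N₁ N₀) N≤m) ⟩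
    (δ * δ) * ε ∎)
    where
    open ≤-Reasoning
    open +-*-Solver
    p = a m
    q = a n
    u = recip p
    v = recip q
    N₀≤m = ℕ.≤-trans (ℕ.m≤m+n N₀ N₁) N≤m
    N₀≤n = ℕ.≤-trans (ℕ.m≤m+n N₀ N₁) N≤n

fromℚ : ℚ → ℝ
fromℚ q = mkℝ (λ _ → q) λ ε 0<ε → 0 , λ _ _ _ _ →
  subst (_< ε) (sym (cong ∣_∣ (+-inverseʳ q))) 0<ε

infixl 7 _*ℝ_

_*ℝ_ : ℝ → ℝ → ℝ
x *ℝ y = mkℝ (λ n → seq x n * seq y n) (*-cauchy (seq x) (seq y) (cauchy x) (cauchy y))

inverse : (x : ℝ) → x #0 → ℝ
inverse x x#0 = mkℝ (λ n → recip (seq x n)) (recip-cauchy x x#0)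

-- The n-term Taylor sum evaluated at the n-th approximation of x.  Since
-- the Taylor series converges locally uniformly, this represents its sum at x;
-- at x = fromℚ r the sequence is literally that of the partial sums at r.

sin cos : ℝ → ℝ
sin x = mkℝ (λ n → sinPoly n (seq x n))
  (diagonal-cauchy (λ k → 2 ℕ.* k ℕ.+ 1)
    (λ k → ℕ.≤-trans (ℕ.m≤n*m k 2) (ℕ.m≤m+n (2 ℕ.* k) 1)) (seq x) (cauchy x))
cos x = mkℝ (λ n → cosPoly n (seq x n))
  (diagonal-cauchy (λ k → 2 ℕ.* k) (λ k → ℕ.m≤n*m k 2) (seq x) (cauchy x))

tan : (x : ℝ) → cos x #0 → ℝ
tan x cosx#0 = sin x *ℝ inverse (cos x) cosx#0

Irrational : ℝ → Set
Irrational x = ¬ (∃[ q ] x ≃ fromℚ q)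

{-# OPTIONS --safe #-}
module Submission where

-- Put y = x² and H n = Σⱼ (-1)ʲ yⁿ⁺ʲ / ((2n+2j+1)!! (2j)!!).  Then x (H 0) = sin x,
-- H 1 = H 0 - cos x and H (n+2) = (2n+3) H (n+1) - y (H n), so for x = a/b the
-- number b²ⁿ (H n) is an integer combination of sin x / x and cos x.  For large
-- n the alternating series lies between half its first term and its first
-- term, so b²ⁿ (H n) is positive, and it tends to 0.  Having such
-- arbitrarily small positive integer combinations forces cos x, and likewise
-- v (sin x / x) - u cos x for integers u and v ≠ 0, to be apart from 0.

open import Defs
open import Data.Integer as ℤ using (ℤ; +_; -[1+_])
import Data.Integer.Properties as ℤ
open import Data.Nat as ℕ using (ℕ; zero; suc)
import Data.Nat.Properties as ℕ
import Data.Nat.Tactic.RingSolver as ℕ-Solver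
open import Data.Product using (Σ-syntax; ∃-syntax; _×_; _,_; proj₁; proj₂)
open import Data.Rational as ℚ
  using (ℚ; 0ℚ; 1ℚ; ½; _+_; _*_; _-_; -_; _/_; ∣_∣; _≤_; _<_; ↥_; ↧_)
open import Data.Rational.Properties
open import Data.Rational.Solver using (module +-*-Solver)
open import Data.Rational.Unnormalised as ℚᵘ using (mkℚᵘ; *≡*)
import Data.Rational.Unnormalised.Properties as ℚᵘ
open import Data.Sum using (_⊎_; inj₁; inj₂)
open import Function using (_∘_)
open import Relation.Binary.Definitions using (tri<; tri≈; tri>)
open import Relation.Binary.PropositionalEquality
  using (_≡_; _≢_; refl; sym; trans; cong; cong₂; subst; subst₂; module ≡-Reasoning)
open import Relation.Nullary using (contradiction)

0<-* : ∀ {p q} → 0ℚ < p → 0ℚ < q → 0ℚ < p * q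
0<-* {p} {q} 0<p 0<q =
  positive⁻¹ (p * q) {{pos*pos⇒pos p {{ℚ.positive 0<p}} q {{ℚ.positive 0<q}}}}

0<p*p : ∀ {p} → p ≢ 0ℚ → 0ℚ < p * p
0<p*p {p} p≢0 with <-cmp 0ℚ p
... | tri< 0<p _ _ = 0<-* 0<p 0<p
... | tri≈ _ 0≡p _ = contradiction (sym 0≡p) p≢0
... | tri> _ _ p<0 = positive⁻¹ (p * p) {{neg*neg⇒pos p {{ℚ.negative p<0}} p {{ℚ.negative p<0}}}}

*-monoʳ : ∀ {p q r} → 0ℚ ≤ r → p ≤ q → r * p ≤ r * q
*-monoʳ {r = r} 0≤r = *-monoˡ-≤-nonNeg r {{ℚ.nonNegative 0≤r}}

*-monoˡ : ∀ {p q r} → 0ℚ ≤ r → p ≤ q → p * r ≤ q * r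
*-monoˡ {r = r} 0≤r = *-monoʳ-≤-nonNeg r {{ℚ.nonNegative 0≤r}}

*-cancelˡ-≡ : ∀ {p q r} → r ≢ 0ℚ → r * p ≡ r * q → p ≡ q
*-cancelˡ-≡ {p} {q} {r} r≢0 eq = begin
  p               ≡⟨ undo p ⟨
  recip r * (r * p) ≡⟨ cong (recip r *_) eq ⟩
  recip r * (r * q) ≡⟨ undo q ⟩
  q               ∎
  where
  open ≡-Reasoning
  open +-*-Solver
  undo : ∀ z → recip r * (r * z) ≡ z
  undo z = trans (solve 3 (λ i r z → i :* (r :* z) := (r :* i) :* z) refl (recip r) r z)
    (trans (cong (_* z) (recip-inverse r r≢0)) (*-identityˡ z))

p≤∣p∣ : ∀ p → p ≤ ∣ p ∣
p≤∣p∣ p with ≤-total 0ℚ p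
... | inj₁ 0≤p = ≤-reflexive (sym (0≤p⇒∣p∣≡p 0≤p))
... | inj₂ p≤0 = ≤-trans p≤0 (0≤∣p∣ p)

p-q≤p : ∀ {p q} → 0ℚ ≤ q → p - q ≤ p
p-q≤p {p} {q} 0≤q = subst (p - q ≤_) (+-identityʳ p) (+-monoʳ-≤ p (neg-antimono-≤ 0≤q))

0≤q-p : ∀ {p q} → p ≤ q → 0ℚ ≤ q - p
0≤q-p {p} {q} p≤q = subst (_≤ q - p) (+-inverseʳ p) (+-monoˡ-≤ (- p) p≤q)

-- Integers among the rationals

ι : ℤ → ℚ
ι z = z / 1

ν : ℕ → ℚ
ν n = ι (+ n)

toℚᵘ-ι : ∀ z → ℚ.toℚᵘ (ι z) ℚᵘ.≃ mkℚᵘ z 0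
toℚᵘ-ι z = toℚᵘ-fromℚᵘ (mkℚᵘ z 0)

ι-+ : ∀ a b → ι (a ℤ.+ b) ≡ ι a + ι b
ι-+ a b = toℚᵘ-injective (begin
  ℚ.toℚᵘ (ι (a ℤ.+ b))              ≈⟨ toℚᵘ-ι (a ℤ.+ b) ⟩
  mkℚᵘ (a ℤ.+ b) 0                  ≡⟨ cong (λ z → mkℚᵘ z 0) (cong₂ ℤ._+_ (ℤ.*-identityʳ a) (ℤ.*-identityʳ b)) ⟨
  mkℚᵘ a 0 ℚᵘ.+ mkℚᵘ b 0            ≈⟨ ℚᵘ.+-cong (toℚᵘ-ι a) (toℚᵘ-ι b) ⟨
  ℚ.toℚᵘ (ι a) ℚᵘ.+ ℚ.toℚᵘ (ι b)    ≈⟨ toℚᵘ-homo-+ (ι a) (ι b) ⟨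
  ℚ.toℚᵘ (ι a + ι b)                ∎)
  where open ℚᵘ.≃-Reasoning

ι-* : ∀ a b → ι (a ℤ.* b) ≡ ι a * ι b
ι-* a b = toℚᵘ-injective (begin
  ℚ.toℚᵘ (ι (a ℤ.* b))              ≈⟨ toℚᵘ-ι (a ℤ.* b) ⟩
  mkℚᵘ a 0 ℚᵘ.* mkℚᵘ b 0            ≈⟨ ℚᵘ.*-cong (toℚᵘ-ι a) (toℚᵘ-ι b) ⟨
  ℚ.toℚᵘ (ι a) ℚᵘ.* ℚ.toℚᵘ (ι b)    ≈⟨ toℚᵘ-homo-* (ι a) (ι b) ⟨
  ℚ.toℚᵘ (ι a * ι b)                ∎)
  where open ℚᵘ.≃-Reasoning

ι-neg : ∀ a → ι (ℤ.- a) ≡ - ι a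
ι-neg a = toℚᵘ-injective (begin
  ℚ.toℚᵘ (ι (ℤ.- a))   ≈⟨ toℚᵘ-ι (ℤ.- a) ⟩
  ℚᵘ.- mkℚᵘ a 0        ≈⟨ ℚᵘ.-‿cong (toℚᵘ-ι a) ⟨
  ℚᵘ.- ℚ.toℚᵘ (ι a)    ≈⟨ toℚᵘ-homo‿- (ι a) ⟨
  ℚ.toℚᵘ (- ι a)       ∎)
  where open ℚᵘ.≃-Reasoning

p*↧p≡↥p : ∀ p → p * ι (↧ p) ≡ ι (↥ p)
p*↧p≡↥p p@record{} = toℚᵘ-injective (begin
  ℚ.toℚᵘ (p * ι (↧ p))              ≈⟨ toℚᵘ-homo-* p (ι (↧ p)) ⟩
  ℚ.toℚᵘ p ℚᵘ.* ℚ.toℚᵘ (ι (↧ p))    ≈⟨ ℚᵘ.*-cong (ℚᵘ.≃-refl {ℚ.toℚᵘ p}) (toℚᵘ-ι (↧ p)) ⟩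
  ℚ.toℚᵘ p ℚᵘ.* mkℚᵘ (↧ p) 0        ≈⟨ *≡* (trans (ℤ.*-identityʳ (↥ p ℤ.* ↧ p)) (cong (↥ p ℤ.*_) (sym (ℤ.*-identityʳ (↧ p))))) ⟩
  mkℚᵘ (↥ p) 0                      ≈⟨ toℚᵘ-ι (↥ p) ⟨
  ℚ.toℚᵘ (ι (↥ p))                  ∎)
  where open ℚᵘ.≃-Reasoning

ν-mono : ∀ {m n} → m ℕ.≤ n → ν m ≤ ν n
ν-mono {m} {n} m≤n = /-≤ m n 1 1 (ℕ.*-monoˡ-≤ 1 m≤n)

0≤ν : ∀ n → 0ℚ ≤ ν n
0≤ν n = 0≤/ n 1

0<ν : ∀ n → 0ℚ < ν (suc n)
0<ν n = <-≤-trans (positive⁻¹ 1ℚ) (ν-mono {1} {suc n} (ℕ.s≤s ℕ.z≤n))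

ν≢0 : ∀ n → ν (suc n) ≢ 0ℚ
ν≢0 n ν≡0 = <-irrefl (sym ν≡0) (0<ν n)

ν-suc : ∀ n → ν (suc n) ≡ 1ℚ + ν n
ν-suc n = ι-+ (+ 1) (+ n)

ν-2* : ∀ n → ν (2 ℕ.* n) ≡ (1ℚ + 1ℚ) * ν n
ν-2* n = trans (cong ι (ℤ.pos-* 2 n)) (ι-* (+ 2) (+ n))

recipSuc : ℕ → ℚ
recipSuc n = + 1 / suc n

ν*recipSuc : ∀ n → ν (suc n) * recipSuc n ≡ 1ℚ
ν*recipSuc n = trans (/-* (suc n) 1 1 (suc n))
  (toℚᵘ-injective (ℚᵘ.≃-trans (toℚᵘ-fromℚᵘ (mkℚᵘ (+ (suc n ℕ.* 1)) (n ℕ.+ 0)))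
    (*≡* (cong +_ (trans (ℕ.*-identityʳ (suc n ℕ.* 1))
      (trans (ℕ.*-comm (suc n) 1) (sym (ℕ.*-identityˡ (1 ℕ.* suc n)))))))))

0<recipSuc : ∀ n → 0ℚ < recipSuc n
0<recipSuc n = /-< 0 1 1 (suc n) (ℕ.s≤s ℕ.z≤n)

IsInt : ℚ → Set
IsInt p = ∃[ z ] p ≡ ι z

int-* : ∀ {p q} → IsInt p → IsInt q → IsInt (p * q)
int-* (a , refl) (b , refl) = a ℤ.* b , sym (ι-* a b)

int-+ : ∀ {p q} → IsInt p → IsInt q → IsInt (p + q)
int-+ (a , refl) (b , refl) = a ℤ.+ b , sym (ι-+ a b)

int-neg : ∀ {p} → IsInt p → IsInt (- p)
int-neg (a , refl) = ℤ.- a , sym (ι-neg a)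

int-zero-or-large : ∀ {p} → IsInt p → p ≡ 0ℚ ⊎ 1ℚ ≤ ∣ p ∣
int-zero-or-large (+ zero    , refl) = inj₁ refl
int-zero-or-large (+ suc n   , refl) = inj₂ (≤-trans (ν-mono {1} {suc n} (ℕ.s≤s ℕ.z≤n)) (p≤∣p∣ (ν (suc n))))
int-zero-or-large (-[1+ n ] , refl) = inj₂ (≤-trans (ν-mono {1} {suc n} (ℕ.s≤s ℕ.z≤n))
  (≤-trans (p≤∣p∣ (ν (suc n))) (≤-reflexive (sym (trans (cong ∣_∣ (ι-neg (+ suc n))) (∣-p∣≡∣p∣ (ν (suc n))))))))

-- Asymptotics of rational sequences

Eventually : (ℕ → Set) → Set
Eventually P = ∃[ N ] (∀ n → N ℕ.≤ n → P n)

eventually₂ : ∀ {P Q R : ℕ → Set} → (∀ n → P n → Q n → R n) →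
              Eventually P → Eventually Q → Eventually R
eventually₂ f (M , p) (N , q) = M ℕ.+ N , λ n le →
  f n (p n (ℕ.≤-trans (ℕ.m≤m+n M N) le)) (q n (ℕ.≤-trans (ℕ.m≤n+m N M) le))

eventually₁ : ∀ {P Q : ℕ → Set} → (∀ n → P n → Q n) → Eventually P → Eventually Q
eventually₁ f (M , p) = M , λ n le → f n (p n le)

Null Away : (ℕ → ℚ) → Set
Null a = ∀ ε → 0ℚ < ε → Eventually (λ n → ∣ a n ∣ < ε)
Away a = ∃[ δ ] (0ℚ < δ × Eventually (λ n → δ ≤ ∣ a n ∣))

null-cong : ∀ {a b : ℕ → ℚ} → Eventually (λ n → a n ≡ b n) → Null a → Null b
null-cong eq null-a ε 0<ε =
  eventually₂ (λ n → subst (λ z → ∣ z ∣ < ε)) eq (null-a ε 0<ε)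

null-≗ : ∀ {a b : ℕ → ℚ} → (∀ n → a n ≡ b n) → Null a → Null b
null-≗ {a} {b} eq = null-cong {a} {b} (0 , λ n _ → eq n)

null-+ : ∀ {a b : ℕ → ℚ} → Null a → Null b → Null (λ n → a n + b n)
null-+ {a} {b} null-a null-b ε 0<ε = eventually₂
  (λ n p q → ≤-<-trans (∣p+q∣≤∣p∣+∣q∣ (a n) (b n)) (half-sum ∣ a n ∣ ∣ b n ∣ ε p q))
  (null-a (½ * ε) (0<½* ε 0<ε)) (null-b (½ * ε) (0<½* ε 0<ε))

null-bounded-* : ∀ {a b : ℕ → ℚ} B → 0ℚ ≤ B → Eventually (λ n → ∣ b n ∣ ≤ B) → Null a →
                 Null (λ n → b n * a n)
null-bounded-* {a} {b} B 0≤B bound null-a ε 0<ε = choose (shrink B ε 0≤B 0<ε)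
  where
  choose : ∃[ δ ] (0ℚ < δ × (∀ p → 0ℚ ≤ p → p < δ → B * p < ε)) →
           Eventually (λ n → ∣ b n * a n ∣ < ε)
  choose (δ , 0<δ , shr) = eventually₂
    (λ n b≤B a<δ → ≤-<-trans (≤-trans (≤-reflexive (∣p*q∣≡∣p∣*∣q∣ (b n) (a n)))
                               (*-monoˡ {∣ b n ∣} {B} (0≤∣p∣ (a n)) b≤B))
                     (shr ∣ a n ∣ (0≤∣p∣ (a n)) a<δ))
    bound (null-a δ 0<δ)

null-* : ∀ {a : ℕ → ℚ} q → Null a → Null (λ n → q * a n)
null-* {a} q = null-bounded-* {a} {λ _ → q} ∣ q ∣ (0≤∣p∣ q) (0 , λ _ _ → ≤-refl)

null-suc : ∀ {a : ℕ → ℚ} k → Null a → Null (λ n → a (k ℕ.+ n))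
null-suc k null-a ε 0<ε with null-a ε 0<ε
... | N , p = N , λ n le → p (k ℕ.+ n) (ℕ.≤-trans le (ℕ.m≤n+m n k))

null-0 : Null (λ _ → 0ℚ)
null-0 ε 0<ε = 0 , λ _ _ → 0<ε

null-step : ∀ {a : ℕ → ℚ} → IsCauchy a → Null (λ n → a n - a (suc n))
null-step c ε 0<ε with c ε 0<ε
... | N , p = N , λ n le → p n (suc n) le (ℕ.m≤n⇒m≤1+n le)

away-near : ∀ {a b : ℕ → ℚ} → Null (λ n → a n - b n) → Away b → Away a
away-near {a} {b} null (δ , 0<δ , apart) = ½ * δ , 0<½* δ 0<δ , eventually₂
  (λ n close far → ≮⇒≥ λ a<δ/2 → <-irrefl refl (≤-<-trans far
    (≤-<-trans (∣p∣≤∣p-q∣+∣q∣ (b n) (a n))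
      (half-sum ∣ b n - a n ∣ ∣ a n ∣ δ
        (subst (_< ½ * δ) (∣-∣-comm (a n) (b n)) close) a<δ/2))))
  (null (½ * δ) (0<½* δ 0<δ)) apart

away-≤ : ∀ {a b : ℕ → ℚ} q → Eventually (λ n → ∣ a n ∣ ≤ ∣ q ∣ * ∣ b n ∣) → Away a → Away b
away-≤ {a} {b} q bound (δ , 0<δ , apart) = choose (shrink ∣ q ∣ δ (0≤∣p∣ q) 0<δ)
  where
  choose : ∃[ γ ] (0ℚ < γ × (∀ p → 0ℚ ≤ p → p < γ → ∣ q ∣ * p < δ)) → Away b
  choose (γ , 0<γ , shr) = γ , 0<γ , eventually₂
    (λ n le far → ≮⇒≥ λ b<γ → <-irrefl refl
      (≤-<-trans far (≤-<-trans le (shr ∣ b n ∣ (0≤∣p∣ (b n)) b<γ))))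
    bound apart

away-not-null : ∀ {a : ℕ → ℚ} {A : Set} → Away a → Null a → A
away-not-null {a} {A} (δ , 0<δ , apart) null =
  clash (eventually₂ (λ n → ≤-<-trans {δ} {∣ a n ∣} {δ}) apart (null δ 0<δ))
  where
  clash : Eventually (λ _ → δ < δ) → A
  clash (N , δ<δ) = contradiction (δ<δ N ℕ.≤-refl) (<-irrefl refl)

half-null : ∀ u → (∀ n → 0ℚ ≤ u n) →
            ∀ N → (∀ n → N ℕ.≤ n → u (suc n) ≤ ½ * u n) → Null u
half-null u 0≤u N halves ε 0<ε = N ℕ.+ M , small
  where
  decay : ∀ k → ν (suc k) * u (N ℕ.+ k) ≤ u N
  decay zero = ≤-reflexive (trans (*-identityˡ (u (N ℕ.+ 0))) (cong u (ℕ.+-identityʳ N)))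
  decay (suc k) = begin
    ν (suc (suc k)) * u (N ℕ.+ suc k)
      ≡⟨ cong (λ z → ν (suc (suc k)) * u z) (ℕ.+-suc N k) ⟩
    ν (suc (suc k)) * u (suc (N ℕ.+ k))
      ≤⟨ *-monoʳ (0≤ν (suc (suc k))) (halves (N ℕ.+ k) (ℕ.m≤m+n N k)) ⟩
    ν (suc (suc k)) * (½ * v)
      ≤⟨ *-monoˡ (0≤* (nonNegative⁻¹ ½) (0≤u (N ℕ.+ k))) (ν-mono 2+k≤2*[1+k]) ⟩
    ν (2 ℕ.* suc k) * (½ * v)
      ≡⟨ cong (_* (½ * v)) (ν-2* (suc k)) ⟩
    (1ℚ + 1ℚ) * ν (suc k) * (½ * v)
      ≡⟨ solve 2 (λ a v → con (1ℚ + 1ℚ) :* a :* (con ½ :* v) := a :* v) refl (ν (suc k)) v ⟩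
    ν (suc k) * v
      ≤⟨ decay k ⟩
    u N ∎
    where
    open ≤-Reasoning
    open +-*-Solver
    v = u (N ℕ.+ k)
    2+k≤2*[1+k] : suc (suc k) ℕ.≤ 2 ℕ.* suc k
    2+k≤2*[1+k] = ℕ.+-mono-≤ {1} {suc k} (ℕ.s≤s ℕ.z≤n) (ℕ.m≤m+n (suc k) 0)
  ε≢0 : ε ≢ 0ℚ
  ε≢0 ε≡0 = <-irrefl (sym ε≡0) 0<ε
  ratio = u N * recip ε
  M = proj₁ (natBound ratio)
  uN≤Mε : u N ≤ ν M * ε
  uN≤Mε = begin
    u N            ≡⟨ *-identityʳ (u N) ⟨
    u N * 1ℚ       ≡⟨ cong (u N *_) (recip-inverse ε ε≢0) ⟨
    u N * (ε * recip ε) ≡⟨ solve 3 (λ a b c → a :* (b :* c) := (a :* c) :* b) refl (u N) ε (recip ε) ⟩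
    ratio * ε      ≤⟨ *-monoˡ (<⇒≤ 0<ε) (≤-trans (p≤∣p∣ ratio) (proj₂ (proj₂ (natBound ratio)))) ⟩
    ν M * ε        ∎
    where
    open ≤-Reasoning
    open +-*-Solver
  small′ : ∀ k → M ℕ.≤ k → ∣ u (N ℕ.+ k) ∣ < ε
  small′ k M≤k = *-cancelˡ-<-nonNeg (ν (suc k)) {{ℚ.nonNegative (0≤ν (suc k))}} (begin-strict
    ν (suc k) * ∣ u (N ℕ.+ k) ∣ ≡⟨ cong (ν (suc k) *_) (0≤p⇒∣p∣≡p (0≤u (N ℕ.+ k))) ⟩
    ν (suc k) * u (N ℕ.+ k)     ≤⟨ decay k ⟩
    u N                         ≤⟨ uN≤Mε ⟩
    ν M * ε                     ≤⟨ *-monoˡ (<⇒≤ 0<ε) (ν-mono M≤k) ⟩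
    ν k * ε                     <⟨ subst₂ _<_ (+-identityˡ (ν k * ε)) (sym νk+1) (+-monoˡ-< (ν k * ε) 0<ε) ⟩
    ν (suc k) * ε               ∎)
    where
    open ≤-Reasoning
    open +-*-Solver
    νk+1 : ν (suc k) * ε ≡ ε + ν k * ε
    νk+1 = trans (cong (_* ε) (ν-suc k))
      (solve 2 (λ a b → (con 1ℚ :+ a) :* b := b :+ a :* b) refl (ν k) ε)
  small : ∀ n → N ℕ.+ M ℕ.≤ n → ∣ u n ∣ < ε
  small n le = subst (λ z → ∣ u z ∣ < ε) (ℕ.m+[n∸m]≡n (ℕ.≤-trans (ℕ.m≤m+n N M) le))
    (small′ (n ℕ.∸ N) (subst (ℕ._≤ n ℕ.∸ N) (ℕ.m+n∸m≡n N M) (ℕ.∸-monoˡ-≤ N le)))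

-- If integer multiples of y can be combined with multiples of z to give
-- arbitrarily small values that are all apart from 0, then z is apart from 0:
-- small z and P n ≢ 0 force y, hence P M * y + Q M * z, to be small, whereas
-- P n ≡ 0 leaves a multiple of z alone.
away-of-small-forms : ∀ (y z P Q : ℕ → ℚ) M → (∀ n → IsInt (P n)) →
  (∀ n → M ℕ.≤ n → Away (λ k → P n * y k + Q n * z k)) →
  (∀ ε → 0ℚ < ε → ∃[ n ] (M ℕ.≤ n × Eventually (λ k → ∣ P n * y k + Q n * z k ∣ < ε))) →
  Away z
away-of-small-forms y z P Q M int away small =
  start (away M ℕ.≤-refl)
  where
  F : ℕ → ℕ → ℚ
  F n k = P n * y k + Q n * z k
  α : ℚ
  α = ∣ P M ∣

  multiple : ∀ n → P n ≡ 0ℚ → ∀ k → F n k ≡ Q n * z k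
  multiple n P≡0 k = trans (cong (λ p → p * y k + Q n * z k) P≡0)
    (trans (cong (_+ Q n * z k) (*-zeroˡ (y k))) (+-identityˡ (Q n * z k)))

  y-bound : ∀ n k → 1ℚ ≤ ∣ P n ∣ → ∣ y k ∣ ≤ ∣ F n k ∣ + ∣ Q n ∣ * ∣ z k ∣
  y-bound n k 1≤P = begin
    ∣ y k ∣                                ≡⟨ *-identityˡ ∣ y k ∣ ⟨
    1ℚ * ∣ y k ∣                           ≤⟨ *-monoˡ {1ℚ} {∣ P n ∣} (0≤∣p∣ (y k)) 1≤P ⟩
    ∣ P n ∣ * ∣ y k ∣                      ≡⟨ ∣p*q∣≡∣p∣*∣q∣ (P n) (y k) ⟨
    ∣ P n * y k ∣                          ≡⟨ cong ∣_∣ (solve 2 (λ a b → a := (a :+ b) :- b) refl (P n * y k) (Q n * z k)) ⟩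
    ∣ F n k - Q n * z k ∣                  ≤⟨ ∣p-q∣≤∣p∣+∣q∣ (F n k) (Q n * z k) ⟩
    ∣ F n k ∣ + ∣ Q n * z k ∣              ≡⟨ cong (λ w → ∣ F n k ∣ + w) (∣p*q∣≡∣p∣*∣q∣ (Q n) (z k)) ⟩
    ∣ F n k ∣ + ∣ Q n ∣ * ∣ z k ∣          ∎
    where
    open ≤-Reasoning
    open +-*-Solver

  F-bound : ∀ n k → 1ℚ ≤ ∣ P n ∣ →
    ∣ F M k ∣ ≤ α * ∣ F n k ∣ + (α * ∣ Q n ∣ + ∣ Q M ∣) * ∣ z k ∣
  F-bound n k 1≤P = begin
    ∣ P M * y k + Q M * z k ∣              ≤⟨ ∣p+q∣≤∣p∣+∣q∣ (P M * y k) (Q M * z k) ⟩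
    ∣ P M * y k ∣ + ∣ Q M * z k ∣          ≡⟨ cong₂ _+_ (∣p*q∣≡∣p∣*∣q∣ (P M) (y k)) (∣p*q∣≡∣p∣*∣q∣ (Q M) (z k)) ⟩
    α * ∣ y k ∣ + ∣ Q M ∣ * ∣ z k ∣        ≤⟨ +-monoˡ-≤ (∣ Q M ∣ * ∣ z k ∣) (*-monoʳ (0≤∣p∣ (P M)) (y-bound n k 1≤P)) ⟩
    α * (∣ F n k ∣ + ∣ Q n ∣ * ∣ z k ∣) + ∣ Q M ∣ * ∣ z k ∣
      ≡⟨ solve 5 (λ a f q z m → a :* (f :+ q :* z) :+ m :* z := a :* f :+ (a :* q :+ m) :* z)
           refl α (∣ F n k ∣) (∣ Q n ∣) (∣ z k ∣) (∣ Q M ∣) ⟩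
    α * ∣ F n k ∣ + (α * ∣ Q n ∣ + ∣ Q M ∣) * ∣ z k ∣ ∎
    where
    open ≤-Reasoning
    open +-*-Solver

  start : Away (F M) → Away z
  start (τ , 0<τ , apart) = choose (shrink α (½ * τ) (0≤∣p∣ (P M)) (0<½* τ 0<τ))
    where
    use : ∀ δ → (∀ p → 0ℚ ≤ p → p < δ → α * p < ½ * τ) → ∀ n → M ℕ.≤ n →
          Eventually (λ k → ∣ F n k ∣ < δ) → P n ≡ 0ℚ ⊎ 1ℚ ≤ ∣ P n ∣ → Away z
    use δ shr n M≤n close (inj₁ P≡0) = away-≤ {F n} {z} (Q n)
      (0 , λ k _ → ≤-reflexive (trans (cong ∣_∣ (multiple n P≡0 k)) (∣p*q∣≡∣p∣*∣q∣ (Q n) (z k))))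
      (away n M≤n)
    use δ shr n M≤n close (inj₂ 1≤P) = away-≤ {λ _ → ½ * τ} {z} q
      (eventually₂ bound apart close)
      (½ * τ , 0<½* τ 0<τ , 0 , λ _ _ → p≤∣p∣ (½ * τ))
      where
      q = α * ∣ Q n ∣ + ∣ Q M ∣
      0≤q : 0ℚ ≤ q
      0≤q = +-mono-≤ {0ℚ} {α * ∣ Q n ∣} {0ℚ} {∣ Q M ∣} (0≤* (0≤∣p∣ (P M)) (0≤∣p∣ (Q n))) (0≤∣p∣ (Q M))
      bound : ∀ k → τ ≤ ∣ F M k ∣ → ∣ F n k ∣ < δ → ∣ ½ * τ ∣ ≤ ∣ q ∣ * ∣ z k ∣
      bound k far near = subst₂ _≤_ (sym (0≤p⇒∣p∣≡p (<⇒≤ (0<½* τ 0<τ))))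
        (cong (_* ∣ z k ∣) (sym (0≤p⇒∣p∣≡p 0≤q)))
        (≮⇒≥ λ qz<τ/2 → <-irrefl refl (≤-<-trans (≤-trans far (F-bound n k 1≤P))
          (half-sum (α * ∣ F n k ∣) (q * ∣ z k ∣) τ
            (shr ∣ F n k ∣ (0≤∣p∣ (F n k)) near) qz<τ/2)))

    choose : ∃[ δ ] (0ℚ < δ × (∀ p → 0ℚ ≤ p → p < δ → α * p < ½ * τ)) → Away z
    choose (δ , 0<δ , shr) = pick (small δ 0<δ)
      where
      pick : ∃[ n ] (M ℕ.≤ n × Eventually (λ k → ∣ F n k ∣ < δ)) → Away z
      pick (n , M≤n , close) = use δ shr n M≤n close (int-zero-or-large (int n))

-- Alternating sums

alt : (ℕ → ℚ) → ℕ → ℚ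
alt f zero    = 0ℚ
alt f (suc n) = f 0 - alt (f ∘ suc) n

alt-last : ∀ f n → alt f (suc n) ≡ alt f n + (- 1ℚ) ^ℚ n * f n
alt-last f zero    = solve 1 (λ a → a :- con 0ℚ := con 0ℚ :+ con 1ℚ :* a) refl (f 0)
  where open +-*-Solver
alt-last f (suc n) = trans (cong (λ z → f 0 - z) (alt-last (f ∘ suc) n))
  (solve 4 (λ a s σ b → a :- (s :+ σ :* b) := (a :- s) :+ (:- con 1ℚ :* σ) :* b)
    refl (f 0) (alt (f ∘ suc) n) ((- 1ℚ) ^ℚ n) (f (suc n)))
  where open +-*-Solver

alt≡Σ< : ∀ f n → alt f n ≡ Σ< n (λ k → (- 1ℚ) ^ℚ k * f k)
alt≡Σ< f zero    = refl
alt≡Σ< f (suc n) = trans (alt-last f n) (cong (_+ (- 1ℚ) ^ℚ n * f n) (alt≡Σ< f n))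

Σ<-cong : ∀ {f g} → (∀ k → f k ≡ g k) → ∀ n → Σ< n f ≡ Σ< n g
Σ<-cong eq zero    = refl
Σ<-cong eq (suc n) = cong₂ _+_ (Σ<-cong eq n) (eq n)

alt-linear : ∀ p q f g {h} → (∀ k → h k ≡ p * f k - q * g k) →
             ∀ n → alt h n ≡ p * alt f n - q * alt g n
alt-linear p q f g eq zero =
  solve 2 (λ p q → con 0ℚ := p :* con 0ℚ :- q :* con 0ℚ) refl p q
  where open +-*-Solver
alt-linear p q f g eq (suc n) = trans
  (cong₂ _-_ (eq 0) (alt-linear p q (f ∘ suc) (g ∘ suc) (eq ∘ suc) n))
  (solve 6 (λ p q a b s t → (p :* a :- q :* b) :- (p :* s :- q :* t) := p :* (a :- s) :- q :* (b :- t))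
    refl p q (f 0) (g 0) (alt (f ∘ suc) n) (alt (g ∘ suc) n))
  where open +-*-Solver

alt-bounds : ∀ f → (∀ k → 0ℚ ≤ f k) → (∀ k → f (suc k) ≤ f k) →
             ∀ n → 0ℚ ≤ alt f n × alt f n ≤ f 0
alt-bounds f 0≤f dec zero    = ≤-refl , 0≤f 0
alt-bounds f 0≤f dec (suc n) with alt-bounds (f ∘ suc) (0≤f ∘ suc) (dec ∘ suc) n
... | 0≤s , s≤f₁ = 0≤q-p (≤-trans s≤f₁ (dec 0)) , p-q≤p 0≤s

alt-≥half : ∀ f → (∀ k → 0ℚ ≤ f k) → (∀ k → f (suc k) ≤ ½ * f k) →
            ∀ n → ½ * f 0 ≤ alt f (suc n) × alt f (suc n) ≤ f 0
alt-≥half f 0≤f halves n = lower , proj₂ (alt-bounds f 0≤f dec (suc n))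
  where
  open ≤-Reasoning
  open +-*-Solver
  ½p≤p : ∀ {p} → 0ℚ ≤ p → ½ * p ≤ p
  ½p≤p {p} 0≤p = subst (½ * p ≤_) (*-identityˡ p) (*-monoˡ {½} {1ℚ} 0≤p (/-≤ 1 1 2 1 (ℕ.s≤s ℕ.z≤n)))
  dec : ∀ k → f (suc k) ≤ f k
  dec k = ≤-trans (halves k) (½p≤p (0≤f k))
  lower : ½ * f 0 ≤ f 0 - alt (f ∘ suc) n
  lower = begin
    ½ * f 0                  ≡⟨ solve 1 (λ a → con ½ :* a := a :- con ½ :* a) refl (f 0) ⟩
    f 0 - ½ * f 0            ≤⟨ +-monoʳ-≤ (f 0) (neg-antimono-≤ (≤-trans
                                  (proj₂ (alt-bounds (f ∘ suc) (0≤f ∘ suc) (dec ∘ suc) n)) (halves 0))) ⟩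
    f 0 - alt (f ∘ suc) n    ∎

pow/!-suc : ∀ x j → ν (suc j) * (x ^ suc j /!) ≡ x * (x ^ j /!)
pow/!-suc x j = begin
  ν (suc j) * (x * x ^ℚ j * 1/! (suc j))           ≡⟨ cong (λ z → ν (suc j) * (x * x ^ℚ j * z)) 1/!-suc ⟩
  ν (suc j) * (x * x ^ℚ j * (recipSuc j * 1/! j))  ≡⟨ solve 5 (λ n x p r f → n :* (x :* p :* (r :* f)) := (n :* r) :* (x :* (p :* f)))
                                                        refl (ν (suc j)) x (x ^ℚ j) (recipSuc j) (1/! j) ⟩
  (ν (suc j) * recipSuc j) * (x * (x ^ j /!))      ≡⟨ cong (_* (x * (x ^ j /!))) (ν*recipSuc j) ⟩
  1ℚ * (x * (x ^ j /!))                            ≡⟨ *-identityˡ (x * (x ^ j /!)) ⟩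
  x * (x ^ j /!)                                   ∎
  where
  open ≡-Reasoning
  open +-*-Solver
  1/! : ℕ → ℚ
  1/! n = (+ 1 / (n ℕ.!)) {{n ℕ.!≢0}}
  1/!-suc : 1/! (suc j) ≡ recipSuc j * 1/! j
  1/!-suc = sym (/-* 1 1 (suc j) (j ℕ.!) {{_}} {{j ℕ.!≢0}} {{suc j ℕ.!≢0}})

halving-step : ∀ {c u v} M k → c ≤ ν M → M ℕ.≤ k → 0ℚ ≤ u →
               ν (3 ℕ.+ 2 ℕ.* k) * v ≡ c * u → v ≤ ½ * u
halving-step {c} {u} {v} M k c≤M M≤k 0≤u eq =
  *-cancelˡ-≤-pos (ν (3 ℕ.+ 2 ℕ.* k)) {{ℚ.positive (0<ν (2 ℕ.+ 2 ℕ.* k))}} (begin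
    ν (3 ℕ.+ 2 ℕ.* k) * v          ≡⟨ eq ⟩
    c * u                          ≤⟨ *-monoˡ {c} {ν k} 0≤u (≤-trans c≤M (ν-mono M≤k)) ⟩
    ν k * u                        ≡⟨ solve 2 (λ k u → k :* u := (con (1ℚ + 1ℚ) :* k) :* (con ½ :* u)) refl (ν k) u ⟩
    ((1ℚ + 1ℚ) * ν k) * (½ * u)    ≡⟨ cong (_* (½ * u)) (ν-2* k) ⟨
    ν (2 ℕ.* k) * (½ * u)          ≤⟨ *-monoˡ {ν (2 ℕ.* k)} {ν (3 ℕ.+ 2 ℕ.* k)} (0≤* (nonNegative⁻¹ ½) 0≤u) (ν-mono (ℕ.m≤n+m (2 ℕ.* k) 3)) ⟩
    ν (3 ℕ.+ 2 ℕ.* k) * (½ * u)    ∎)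
  where
  open ≤-Reasoning
  open +-*-Solver

-- Lambert's remainders

module Lambert (x : ℚ) (x≢0 : x ≢ 0ℚ) where

  num den y Z W : ℚ
  num = ι (↥ x)
  den = ι (↧ x)
  y = x * x
  Z = den * den
  W = num * num

  W≡yZ : W ≡ y * Z
  W≡yZ = trans (cong₂ _*_ (sym (p*↧p≡↥p x)) (sym (p*↧p≡↥p x)))
    (solve 2 (λ x d → (x :* d) :* (x :* d) := (x :* x) :* (d :* d)) refl x den)
    where open +-*-Solver

  0<y : 0ℚ < y
  0<y = 0<p*p x≢0

  0<Z : 0ℚ < Z
  0<Z = 0<-* 0<den 0<den
    where
    0<den : 0ℚ < den
    0<den = 0<ν (ℚ.denominator-1 x)

  -- D m = yᵐ / (2m + 1)!!  and  e j = 1 / (2j)!!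
  D e : ℕ → ℚ
  D zero    = 1ℚ
  D (suc m) = D m * (y * recipSuc (2 ℕ.+ 2 ℕ.* m))
  e zero    = 1ℚ
  e (suc j) = e j * recipSuc (1 ℕ.+ 2 ℕ.* j)

  D-suc : ∀ m → ν (3 ℕ.+ 2 ℕ.* m) * D (suc m) ≡ y * D m
  D-suc m = trans
    (solve 4 (λ n d y r → n :* (d :* (y :* r)) := (n :* r) :* (y :* d)) refl
      (ν (3 ℕ.+ 2 ℕ.* m)) (D m) y (recipSuc (2 ℕ.+ 2 ℕ.* m)))
    (trans (cong (_* (y * D m)) (ν*recipSuc (2 ℕ.+ 2 ℕ.* m))) (*-identityˡ (y * D m)))
    where open +-*-Solver

  e-suc : ∀ j → ν (2 ℕ.+ 2 ℕ.* j) * e (suc j) ≡ e j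
  e-suc j = trans
    (solve 3 (λ n e r → n :* (e :* r) := (n :* r) :* e) refl
      (ν (2 ℕ.+ 2 ℕ.* j)) (e j) (recipSuc (1 ℕ.+ 2 ℕ.* j)))
    (trans (cong (_* e j) (ν*recipSuc (1 ℕ.+ 2 ℕ.* j))) (*-identityˡ (e j)))
    where open +-*-Solver

  0<D : ∀ m → 0ℚ < D m
  0<D zero    = positive⁻¹ 1ℚ
  0<D (suc m) = 0<-* (0<D m) (0<-* 0<y (0<recipSuc (2 ℕ.+ 2 ℕ.* m)))

  0<e : ∀ j → 0ℚ < e j
  0<e zero    = positive⁻¹ 1ℚ
  0<e (suc j) = 0<-* (0<e j) (0<recipSuc (1 ℕ.+ 2 ℕ.* j))

  e-dec : ∀ j → e (suc j) ≤ e j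
  e-dec j = begin
    e (suc j)                          ≡⟨ *-identityˡ (e (suc j)) ⟨
    1ℚ * e (suc j)                     ≤⟨ *-monoˡ {1ℚ} {ν (2 ℕ.+ 2 ℕ.* j)} (<⇒≤ (0<e (suc j))) (ν-mono {1} {2 ℕ.+ 2 ℕ.* j} (ℕ.s≤s ℕ.z≤n)) ⟩
    ν (2 ℕ.+ 2 ℕ.* j) * e (suc j)      ≡⟨ e-suc j ⟩
    e j                                ∎
    where open ≤-Reasoning

  e≤1 : ∀ j → e j ≤ 1ℚ
  e≤1 zero    = ≤-refl
  e≤1 (suc j) = ≤-trans (e-dec j) (e≤1 j)

  T : ℕ → ℕ → ℚ
  T n j = D (n ℕ.+ j) * e j

  0≤T : ∀ n j → 0ℚ ≤ T n j
  0≤T n j = <⇒≤ (0<-* (0<D (n ℕ.+ j)) (0<e j))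

  T-rec : ∀ n j → T (2 ℕ.+ n) j ≡ y * T n (suc j) - ν (3 ℕ.+ 2 ℕ.* n) * T (suc n) (suc j)
  T-rec n j rewrite ℕ.+-suc n j = begin
    D″ * e j                                 ≡⟨ cong (D″ *_) (e-suc j) ⟨
    D″ * (b * e′)                            ≡⟨ solve 4 (λ d a b f → d :* (b :* f) := (a :+ b) :* d :* f :- a :* (d :* f)) refl D″ a b e′ ⟩
    (a + b) * D″ * e′ - a * (D″ * e′)        ≡⟨ cong (λ z → z * D″ * e′ - a * (D″ * e′)) a+b ⟨
    ν (3 ℕ.+ 2 ℕ.* suc m) * D″ * e′ - a * (D″ * e′) ≡⟨ cong (λ z → z * e′ - a * (D″ * e′)) (D-suc (suc m)) ⟩
    y * D (suc m) * e′ - a * (D″ * e′)       ≡⟨ cong (_- a * (D″ * e′)) (*-assoc y (D (suc m)) e′) ⟩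
    y * (D (suc m) * e′) - a * (D″ * e′)     ∎
    where
    open ≡-Reasoning
    open +-*-Solver
    m = n ℕ.+ j
    D″ = D (suc (suc m))
    e′ = e (suc j)
    a = ν (3 ℕ.+ 2 ℕ.* n)
    b = ν (2 ℕ.+ 2 ℕ.* j)
    index : ∀ n j → 3 ℕ.+ 2 ℕ.* suc (n ℕ.+ j) ≡ (3 ℕ.+ 2 ℕ.* n) ℕ.+ (2 ℕ.+ 2 ℕ.* j)
    index = ℕ-Solver.solve-∀
    a+b : ν (3 ℕ.+ 2 ℕ.* suc m) ≡ a + b
    a+b = trans (cong ν (index n j)) (ι-+ (+ (3 ℕ.+ 2 ℕ.* n)) (+ (2 ℕ.+ 2 ℕ.* j)))

  T-0 : ∀ n → T n 0 ≡ D n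
  T-0 n = trans (*-identityʳ (D (n ℕ.+ 0))) (cong D (ℕ.+-identityʳ n))

  T-head : ∀ n → ν (3 ℕ.+ 2 ℕ.* n) * T (suc n) 0 ≡ y * T n 0
  T-head n = trans (cong (ν (3 ℕ.+ 2 ℕ.* n) *_) (T-0 (suc n)))
    (trans (D-suc n) (cong (y *_) (sym (T-0 n))))

  H : ℕ → ℕ → ℚ
  H n = alt (T n)

  H-rec : ∀ n k → H (2 ℕ.+ n) k ≡ ν (3 ℕ.+ 2 ℕ.* n) * H (suc n) (suc k) - y * H n (suc k)
  H-rec n k = begin
    H (2 ℕ.+ n) k                 ≡⟨ alt-linear y a (T n ∘ suc) (T (suc n) ∘ suc) (T-rec n) k ⟩
    y * p - a * q                 ≡⟨ solve 5 (λ y a p q t → y :* p :- a :* q := (t :- a :* q) :- (t :- y :* p)) refl y a p q (y * t) ⟩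
    (y * t - a * q) - (y * t - y * p)
                                  ≡⟨ cong (λ z → (z - a * q) - (y * t - y * p)) (T-head n) ⟨
    (a * s - a * q) - (y * t - y * p)
                                  ≡⟨ solve 6 (λ y a p q s t → (a :* s :- a :* q) :- (y :* t :- y :* p) := a :* (s :- q) :- y :* (t :- p)) refl y a p q s t ⟩
    a * (s - q) - y * (t - p)     ∎
    where
    open ≡-Reasoning
    open +-*-Solver
    a = ν (3 ℕ.+ 2 ℕ.* n)
    p = alt (T n ∘ suc) k
    q = alt (T (suc n) ∘ suc) k
    s = T (suc n) 0
    t = T n 0

  C : ℕ → ℚ
  C j = ν (1 ℕ.+ 2 ℕ.* j) * T 0 j

  h c : ℕ → ℚ
  h = H 0
  c = alt C

  2*suc : ∀ j → 2 ℕ.* suc j ≡ 2 ℕ.+ 2 ℕ.* j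
  2*suc j = ℕ.*-suc 2 j

  H-1 : ∀ k → H 1 k ≡ h (suc k) - c (suc k)
  H-1 k = trans (alt-linear 1ℚ 1ℚ (C ∘ suc) (T 0 ∘ suc) T-1 k)
    (solve 2 (λ p q → con 1ℚ :* p :- con 1ℚ :* q := (con 1ℚ :- q) :- (con 1ℚ :- p)) refl
      (alt (C ∘ suc) k) (alt (T 0 ∘ suc) k))
    where
    open +-*-Solver
    T-1 : ∀ j → T 1 j ≡ 1ℚ * C (suc j) - 1ℚ * T 0 (suc j)
    T-1 j = begin
      D (suc j) * e j                              ≡⟨ cong (D (suc j) *_) (e-suc j) ⟨
      D (suc j) * (b * e′)                         ≡⟨ solve 3 (λ d b f → d :* (b :* f) := con 1ℚ :* ((con 1ℚ :+ b) :* (d :* f)) :- con 1ℚ :* (d :* f)) refl (D (suc j)) b e′ ⟩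
      1ℚ * ((1ℚ + b) * (D (suc j) * e′)) - 1ℚ * (D (suc j) * e′)
                                                   ≡⟨ cong (λ z → 1ℚ * (z * (D (suc j) * e′)) - 1ℚ * (D (suc j) * e′))
                                                        (trans (cong (λ z → ν (1 ℕ.+ z)) (2*suc j)) (ν-suc (2 ℕ.+ 2 ℕ.* j))) ⟨
      1ℚ * C (suc j) - 1ℚ * T 0 (suc j)            ∎
      where
      open ≡-Reasoning
      b = ν (2 ℕ.+ 2 ℕ.* j)
      e′ = e (suc j)

  sin-coeff : ∀ j → x ^ suc (2 ℕ.* j) /! ≡ x * T 0 j
  cos-coeff : ∀ j → x ^ (2 ℕ.* j) /! ≡ C j

  sin-coeff j = *-cancelˡ-≡ (ν≢0 (2 ℕ.* j)) (begin
    a * (x ^ suc (2 ℕ.* j) /!)   ≡⟨ pow/!-suc x (2 ℕ.* j) ⟩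
    x * (x ^ (2 ℕ.* j) /!)       ≡⟨ cong (x *_) (cos-coeff j) ⟩
    x * (a * T 0 j)              ≡⟨ solve 3 (λ x a t → x :* (a :* t) := a :* (x :* t)) refl x a (T 0 j) ⟩
    a * (x * T 0 j)              ∎)
    where
    open ≡-Reasoning
    open +-*-Solver
    a = ν (1 ℕ.+ 2 ℕ.* j)

  cos-coeff zero    = refl
  cos-coeff (suc j) = *-cancelˡ-≡ (ν≢0 (1 ℕ.+ 2 ℕ.* j)) (begin
    b * (x ^ (2 ℕ.* suc j) /!)              ≡⟨ cong (λ i → b * (x ^ i /!)) (2*suc j) ⟩
    b * (x ^ suc (suc (2 ℕ.* j)) /!)        ≡⟨ pow/!-suc x (suc (2 ℕ.* j)) ⟩
    x * (x ^ suc (2 ℕ.* j) /!)              ≡⟨ cong (x *_) (sin-coeff j) ⟩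
    x * (x * (D j * e j))                   ≡⟨ cong (λ z → x * (x * (D j * z))) (e-suc j) ⟨
    x * (x * (D j * (b * e′)))              ≡⟨ solve 4 (λ x d b f → x :* (x :* (d :* (b :* f))) := b :* (((x :* x) :* d) :* f)) refl x (D j) b e′ ⟩
    b * ((y * D j) * e′)                    ≡⟨ cong (λ z → b * (z * e′)) (D-suc j) ⟨
    b * ((ν (3 ℕ.+ 2 ℕ.* j) * D (suc j)) * e′) ≡⟨ cong (b *_) (*-assoc (ν (3 ℕ.+ 2 ℕ.* j)) (D (suc j)) e′) ⟩
    b * (ν (3 ℕ.+ 2 ℕ.* j) * T 0 (suc j))   ≡⟨ cong (λ i → b * (ν (1 ℕ.+ i) * T 0 (suc j))) (2*suc j) ⟨
    b * C (suc j)                           ∎)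
    where
    open ≡-Reasoning
    open +-*-Solver
    b = ν (2 ℕ.+ 2 ℕ.* j)
    e′ = e (suc j)

  sinPoly≡ : ∀ k → sinPoly k x ≡ x * h k
  sinPoly≡ k = begin
    sinPoly k x                                  ≡⟨ Σ<-cong term k ⟩
    Σ< k (λ j → (- 1ℚ) ^ℚ j * (x * T 0 j))       ≡⟨ alt≡Σ< (λ j → x * T 0 j) k ⟨
    alt (λ j → x * T 0 j) k                      ≡⟨ alt-linear x 0ℚ (T 0) (T 0) drop k ⟩
    x * h k - 0ℚ * h k                           ≡⟨ solve 2 (λ x a → x :* a :- con 0ℚ :* a := x :* a) refl x (h k) ⟩
    x * h k                                      ∎
    where
    open ≡-Reasoning
    open +-*-Solver
    term : ∀ j → sinTerm x j ≡ (- 1ℚ) ^ℚ j * (x * T 0 j)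
    term j = cong ((- 1ℚ) ^ℚ j *_)
      (trans (cong (λ i → x ^ i /!) (ℕ.+-comm (2 ℕ.* j) 1)) (sin-coeff j))
    drop : ∀ j → x * T 0 j ≡ x * T 0 j - 0ℚ * T 0 j
    drop j = solve 2 (λ x a → x :* a := x :* a :- con 0ℚ :* a) refl x (T 0 j)

  cosPoly≡ : ∀ k → cosPoly k x ≡ c k
  cosPoly≡ k = trans (Σ<-cong (λ j → cong ((- 1ℚ) ^ℚ j *_) (cos-coeff j)) k) (sym (alt≡Σ< C k))

  N₀ : ℕ
  N₀ = proj₁ (natBound y)

  D-halves : ∀ m → N₀ ℕ.≤ m → D (suc m) ≤ ½ * D m
  D-halves m N₀≤m = halving-step N₀ m (≤-trans (p≤∣p∣ y) (proj₂ (proj₂ (natBound y))))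
    N₀≤m (<⇒≤ (0<D m)) (D-suc m)

  D-null : Null D
  D-null = half-null D (λ m → <⇒≤ (0<D m)) N₀ D-halves

  T-null : ∀ n → Null (T n)
  T-null n = null-≗ (λ j → *-comm (e j) (D (n ℕ.+ j)))
    (null-bounded-* {λ j → D (n ℕ.+ j)} {e} 1ℚ (nonNegative⁻¹ 1ℚ)
      (0 , λ j _ → ≤-trans (≤-reflexive (0≤p⇒∣p∣≡p (<⇒≤ (0<e j)))) (e≤1 j))
      (null-suc {D} n D-null))

  T-halves : ∀ n → N₀ ℕ.≤ n → ∀ j → T n (suc j) ≤ ½ * T n j
  T-halves n N₀≤n j = begin
    D (n ℕ.+ suc j) * e (suc j)      ≡⟨ cong (λ i → D i * e (suc j)) (ℕ.+-suc n j) ⟩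
    D (suc (n ℕ.+ j)) * e (suc j)    ≤⟨ *-mono-≤-0 {D (suc (n ℕ.+ j))} {½ * D (n ℕ.+ j)} {e (suc j)} {e j}
                                          (<⇒≤ (0<e (suc j)))
                                          (D-halves (n ℕ.+ j) (ℕ.≤-trans N₀≤n (ℕ.m≤m+n n j)))
                                          (<⇒≤ (0<½* (D (n ℕ.+ j)) (0<D (n ℕ.+ j)))) (e-dec j) ⟩
    ½ * D (n ℕ.+ j) * e j            ≡⟨ *-assoc ½ (D (n ℕ.+ j)) (e j) ⟩
    ½ * T n j                        ∎
    where open ≤-Reasoning

  H-step-null : ∀ n → Null (λ k → H n k - H n (suc k))
  H-step-null n = null-≗ step
    (null-* {λ k → σ k * T n k} (- 1ℚ)
      (null-bounded-* {T n} {σ} 1ℚ (nonNegative⁻¹ 1ℚ)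
        (0 , λ k _ → ≤-reflexive (Taylor.∣±1∣ 1 (ℕ.s≤s ℕ.z≤n) k)) (T-null n)))
    where
    open +-*-Solver
    σ : ℕ → ℚ
    σ k = (- 1ℚ) ^ℚ k
    step : ∀ k → - 1ℚ * (σ k * T n k) ≡ H n k - H n (suc k)
    step k = trans (solve 2 (λ s t → :- con 1ℚ :* t := s :- (s :+ t)) refl (H n k) (σ k * T n k))
      (cong (λ z → H n k - z) (sym (alt-last (T n) k)))

  c-step-null : Null (λ k → c k - c (suc k))
  c-step-null = null-≗ (λ k → cong₂ _-_ (cosPoly≡ k) (cosPoly≡ (suc k)))
    (null-step {seq (cos (fromℚ x))} (cauchy (cos (fromℚ x))))

  E : ℕ → ℕ → ℚ
  E n k = Z ^ℚ n * H n k

  recurrence : ℚ → ℚ → ℕ → ℚ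
  recurrence p q zero          = p
  recurrence p q (suc zero)    = q
  recurrence p q (suc (suc n)) =
    ν (3 ℕ.+ 2 ℕ.* n) * Z * recurrence p q (suc n) - W * Z * recurrence p q n

  A B : ℕ → ℚ
  A = recurrence 1ℚ Z
  B = recurrence 0ℚ (- Z)

  form : ℕ → ℕ → ℚ
  form n k = A n * h k + B n * c k

  Z-int : IsInt Z
  Z-int = int-* (↧ x , refl) (↧ x , refl)

  recurrence-int : ∀ {p q} → IsInt p → IsInt q → ∀ n → IsInt (recurrence p q n)
  recurrence-int ip iq zero          = ip
  recurrence-int ip iq (suc zero)    = iq
  recurrence-int ip iq (suc (suc n)) = int-+
    (int-* (int-* (+ (3 ℕ.+ 2 ℕ.* n) , refl) Z-int) (recurrence-int ip iq (suc n)))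
    (int-neg (int-* (int-* (int-* (↥ x , refl) (↥ x , refl)) Z-int) (recurrence-int ip iq n)))

  A-int : ∀ n → IsInt (A n)
  A-int = recurrence-int (+ 1 , refl) Z-int

  B-int : ∀ n → IsInt (B n)
  B-int = recurrence-int (+ 0 , refl) (int-neg Z-int)

  E-step-null : ∀ n → Null (λ k → E n k - E n (suc k))
  E-step-null n = null-≗
    (λ k → solve 3 (λ z a b → z :* (a :- b) := z :* a :- z :* b) refl (Z ^ℚ n) (H n k) (H n (suc k)))
    (null-* {λ k → H n k - H n (suc k)} (Z ^ℚ n) (H-step-null n))
    where open +-*-Solver

  form-E-null : ∀ n → Null (λ k → form n k - E n k)
  form-E-null zero = null-≗
    (λ k → solve 2 (λ h c → con 0ℚ := (con 1ℚ :* h :+ con 0ℚ :* c) :- con 1ℚ :* h) refl (h k) (c k))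
    null-0
    where open +-*-Solver
  form-E-null (suc zero) = null-≗ eq
    (null-+ {λ k → Z * (h k - h (suc k))} {λ k → - Z * (c k - c (suc k))}
      (null-* {λ k → h k - h (suc k)} Z (H-step-null 0))
      (null-* {λ k → c k - c (suc k)} (- Z) c-step-null))
    where
    open +-*-Solver
    eq : ∀ k → Z * (h k - h (suc k)) + - Z * (c k - c (suc k)) ≡ form 1 k - E 1 k
    eq k = trans
      (solve 5 (λ z h h′ c c′ → z :* (h :- h′) :+ (:- z) :* (c :- c′)
                := (z :* h :+ (:- z) :* c) :- (z :* con 1ℚ) :* (h′ :- c′))
        refl Z (h k) (h (suc k)) (c k) (c (suc k)))
      (cong (λ w → (Z * h k + - Z * c k) - (Z * 1ℚ) * w) (sym (H-1 k)))
  form-E-null (suc (suc n)) = null-≗ eq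
    (null-+ {λ k → a * (Δ (suc n) k + ∂ (suc n) k)} {λ k → - b * (Δ n k + ∂ n k)}
      (null-* {λ k → Δ (suc n) k + ∂ (suc n) k} a
        (null-+ {Δ (suc n)} {∂ (suc n)} (form-E-null (suc n)) (E-step-null (suc n))))
      (null-* {λ k → Δ n k + ∂ n k} (- b)
        (null-+ {Δ n} {∂ n} (form-E-null n) (E-step-null n))))
    where
    open +-*-Solver
    Δ ∂ : ℕ → ℕ → ℚ
    Δ n k = form n k - E n k
    ∂ n k = E n k - E n (suc k)
    l = ν (3 ℕ.+ 2 ℕ.* n)
    a = l * Z
    b = W * Z
    E-rec : ∀ k → E (2 ℕ.+ n) k ≡ a * E (suc n) (suc k) - b * E n (suc k)
    E-rec k = begin
      Z * (Z * z) * H (2 ℕ.+ n) k                ≡⟨ cong (Z * (Z * z) *_) (H-rec n k) ⟩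
      Z * (Z * z) * (l * H₁ - y * H₀)            ≡⟨ solve 6 (λ Z z l H₁ y H₀ → Z :* (Z :* z) :* (l :* H₁ :- y :* H₀)
                                                      := l :* Z :* (Z :* z :* H₁) :- ((y :* Z) :* Z) :* (z :* H₀))
                                                      refl Z z l H₁ y H₀ ⟩
      a * (Z * z * H₁) - ((y * Z) * Z) * (z * H₀) ≡⟨ cong (λ w → a * (Z * z * H₁) - (w * Z) * (z * H₀)) W≡yZ ⟨
      a * (Z * z * H₁) - b * (z * H₀)            ∎
      where
      open ≡-Reasoning
      z = Z ^ℚ n
      H₁ = H (suc n) (suc k)
      H₀ = H n (suc k)
    eq : ∀ k → a * (Δ (suc n) k + ∂ (suc n) k) + - b * (Δ n k + ∂ n k) ≡ form (2 ℕ.+ n) k - E (2 ℕ.+ n) k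
    eq k = trans
      (solve 12 (λ a b A₁ A₀ B₁ B₀ h c E₁ E₀ E₁′ E₀′ →
          a :* (((A₁ :* h :+ B₁ :* c) :- E₁) :+ (E₁ :- E₁′)) :+ (:- b) :* (((A₀ :* h :+ B₀ :* c) :- E₀) :+ (E₀ :- E₀′))
          := ((a :* A₁ :- b :* A₀) :* h :+ (a :* B₁ :- b :* B₀) :* c) :- (a :* E₁′ :- b :* E₀′))
        refl a b (A (suc n)) (A n) (B (suc n)) (B n) (h k) (c k)
          (E (suc n) k) (E n k) (E (suc n) (suc k)) (E n (suc k)))
      (cong (λ w → form (2 ℕ.+ n) k - w) (sym (E-rec k)))

  U : ℕ → ℚ
  U n = Z ^ℚ n * D n

  0<Z^ : ∀ n → 0ℚ < Z ^ℚ n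
  0<Z^ zero    = positive⁻¹ 1ℚ
  0<Z^ (suc n) = 0<-* 0<Z (0<Z^ n)

  0<U : ∀ n → 0ℚ < U n
  0<U n = 0<-* (0<Z^ n) (0<D n)

  U-null : Null U
  U-null = half-null U (λ n → <⇒≤ (0<U n)) (proj₁ (natBound W)) λ n M≤n →
    halving-step (proj₁ (natBound W)) n (≤-trans (p≤∣p∣ W) (proj₂ (proj₂ (natBound W))))
      M≤n (<⇒≤ (0<U n)) (U-suc n)
    where
    U-suc : ∀ n → ν (3 ℕ.+ 2 ℕ.* n) * U (suc n) ≡ W * U n
    U-suc n = begin
      l * (Z * z * D (suc n))    ≡⟨ solve 4 (λ l Z z d → l :* (Z :* z :* d) := Z :* z :* (l :* d)) refl l Z z (D (suc n)) ⟩
      Z * z * (l * D (suc n))    ≡⟨ cong (Z * z *_) (D-suc n) ⟩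
      Z * z * (y * D n)          ≡⟨ solve 4 (λ Z z y d → Z :* z :* (y :* d) := (y :* Z) :* (z :* d)) refl Z z y (D n) ⟩
      (y * Z) * (z * D n)        ≡⟨ cong (_* (z * D n)) W≡yZ ⟨
      W * U n                    ∎
      where
      open ≡-Reasoning
      open +-*-Solver
      l = ν (3 ℕ.+ 2 ℕ.* n)
      z = Z ^ℚ n

  E-bounds : ∀ n → N₀ ℕ.≤ n → ∀ k → ½ * U n ≤ E n (suc k) × E n (suc k) ≤ U n
  E-bounds n N₀≤n k =
    subst (_≤ E n (suc k)) lower (*-monoʳ (<⇒≤ (0<Z^ n)) (proj₁ bounds)) ,
    subst (E n (suc k) ≤_) (cong (Z ^ℚ n *_) (T-0 n)) (*-monoʳ (<⇒≤ (0<Z^ n)) (proj₂ bounds))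
    where
    open +-*-Solver
    bounds = alt-≥half (T n) (0≤T n) (T-halves n N₀≤n) k
    lower : Z ^ℚ n * (½ * T n 0) ≡ ½ * U n
    lower = trans (cong (λ t → Z ^ℚ n * (½ * t)) (T-0 n))
      (solve 2 (λ z d → z :* (con ½ :* d) := con ½ :* (z :* d)) refl (Z ^ℚ n) (D n))

  form-away : ∀ n → N₀ ℕ.≤ n → Away (form n)
  form-away n N₀≤n = away-near {form n} {E n} (form-E-null n)
    (½ * U n , 0<½* (U n) (0<U n) , 1 , λ { (suc k) _ →
      ≤-trans (proj₁ (E-bounds n N₀≤n k)) (p≤∣p∣ (E n (suc k))) })

  form-small : ∀ ε → 0ℚ < ε → ∃[ n ] (N₀ ℕ.≤ n × Eventually (λ k → ∣ form n k ∣ < ε))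
  form-small ε 0<ε = pick (U-null (½ * ε) (0<½* ε 0<ε))
    where
    pick : Eventually (λ n → ∣ U n ∣ < ½ * ε) →
           ∃[ n ] (N₀ ℕ.≤ n × Eventually (λ k → ∣ form n k ∣ < ε))
    pick (N , U-small) = n , ℕ.m≤m+n N₀ N ,
      eventually₂ (λ k near E<ε/2 → ≤-<-trans (∣p∣≤∣p-q∣+∣q∣ (form n k) (E n k))
          (half-sum ∣ form n k - E n k ∣ ∣ E n k ∣ ε near E<ε/2))
        (form-E-null n (½ * ε) (0<½* ε 0<ε))
        (1 , λ { (suc k) _ → E-small k })
      where
      n = N₀ ℕ.+ N
      E-small : ∀ k → ∣ E n (suc k) ∣ < ½ * ε
      E-small k = begin-strict
        ∣ E n (suc k) ∣  ≡⟨ 0≤p⇒∣p∣≡p (≤-trans (<⇒≤ (0<½* (U n) (0<U n))) (proj₁ (E-bounds n (ℕ.m≤m+n N₀ N) k))) ⟩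
        E n (suc k)      ≤⟨ proj₂ (E-bounds n (ℕ.m≤m+n N₀ N) k) ⟩
        U n              ≤⟨ p≤∣p∣ (U n) ⟩
        ∣ U n ∣          <⟨ U-small n (ℕ.m≤n+m N N₀) ⟩
        ½ * ε            ∎
        where open ≤-Reasoning

  c-away : Away c
  c-away = away-of-small-forms h c A B N₀ A-int form-away form-small

  cos-away : cos (fromℚ x) #0
  cos-away = transport c-away
    where
    transport : Away c → cos (fromℚ x) #0
    transport (δ , 0<δ , apart) = δ , 0<δ ,
      eventually₁ (λ k → subst (λ w → δ ≤ ∣ w ∣) (sym (cosPoly≡ k))) apart

  module Rational (p : ℚ) where

    u v : ℚ
    u = ι (↥ p)
    v = ι (↧ p)

    v≢0 : v ≢ 0ℚ
    v≢0 = ν≢0 (ℚ.denominator-1 p)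

    z P : ℕ → ℚ
    z k = v * h k - u * c k
    P n = u * A n + v * B n

    P-form : ∀ n k → P n * c k + A n * z k ≡ v * form n k
    P-form n k = solve 6 (λ u v a b h c → (u :* a :+ v :* b) :* c :+ a :* (v :* h :- u :* c) := v :* (a :* h :+ b :* c))
      refl u v (A n) (B n) (h k) (c k)
      where open +-*-Solver

    P-int : ∀ n → IsInt (P n)
    P-int n = int-+ (int-* (↥ p , refl) (A-int n)) (int-* (↧ p , refl) (B-int n))

    P-away : ∀ n → N₀ ℕ.≤ n → Away (λ k → P n * c k + A n * z k)
    P-away n N₀≤n = away-≤ {form n} (recip v)
      (0 , λ k _ → ≤-reflexive (trans (cong ∣_∣ (undo k)) (∣p*q∣≡∣p∣*∣q∣ (recip v) (P n * c k + A n * z k))))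
      (form-away n N₀≤n)
      where
      open +-*-Solver
      undo : ∀ k → form n k ≡ recip v * (P n * c k + A n * z k)
      undo k = begin
        form n k                            ≡⟨ *-identityˡ (form n k) ⟨
        1ℚ * form n k                       ≡⟨ cong (_* form n k) (recip-inverse v v≢0) ⟨
        (v * recip v) * form n k            ≡⟨ solve 3 (λ v r f → (v :* r) :* f := r :* (v :* f)) refl v (recip v) (form n k) ⟩
        recip v * (v * form n k)            ≡⟨ cong (recip v *_) (P-form n k) ⟨
        recip v * (P n * c k + A n * z k)   ∎
        where open ≡-Reasoning

    P-small : ∀ ε → 0ℚ < ε → ∃[ n ] (N₀ ℕ.≤ n × Eventually (λ k → ∣ P n * c k + A n * z k ∣ < ε))
    P-small ε 0<ε = choose (shrink ∣ v ∣ ε (0≤∣p∣ v) 0<ε)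
      where
      Small : Set
      Small = ∃[ n ] (N₀ ℕ.≤ n × Eventually (λ k → ∣ P n * c k + A n * z k ∣ < ε))
      choose : ∃[ δ ] (0ℚ < δ × (∀ q → 0ℚ ≤ q → q < δ → ∣ v ∣ * q < ε)) → Small
      choose (δ , 0<δ , shr) = scale (form-small δ 0<δ)
        where
        scale : ∃[ n ] (N₀ ℕ.≤ n × Eventually (λ k → ∣ form n k ∣ < δ)) → Small
        scale (n , N₀≤n , near) = n , N₀≤n , eventually₁
          (λ k f<δ → subst (_< ε)
            (sym (trans (cong ∣_∣ (P-form n k)) (∣p*q∣≡∣p∣*∣q∣ v (form n k))))
            (shr ∣ form n k ∣ (0≤∣p∣ (form n k)) f<δ))
          near

    z-away : Away z
    z-away = away-of-small-forms c z P A N₀ P-int P-away P-small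

  tan-irrational : Irrational (tan (fromℚ x) cos-away)
  tan-irrational (q , tan≃q) = away-not-null {z} z-away z-null
    where
    p : ℚ
    p = q * recip x
    open Rational p
    s cs rc t : ℕ → ℚ
    s k = sinPoly k x
    cs k = cosPoly k x
    rc k = recip (cs k)
    t k = s k * rc k - q

    xz : ∀ k → cs k * rc k ≡ 1ℚ → x * z k ≡ (v * cs k) * t k
    xz k inv = begin
      x * (v * h k - u * c k)              ≡⟨ cong₂ (λ a b → x * (v * h k - a * b)) (sym (p*↧p≡↥p p)) (sym (cosPoly≡ k)) ⟩
      x * (v * h k - (q * i * v) * cs k)   ≡⟨ solve 6 (λ x v h q i c → x :* (v :* h :- (q :* i :* v) :* c)
                                                := v :* (x :* h) :- (x :* i) :* (v :* c :* q)) refl x v (h k) q i (cs k) ⟩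
      v * (x * h k) - (x * i) * (v * cs k * q) ≡⟨ cong₂ (λ a b → v * a - b * (v * cs k * q)) (sym (sinPoly≡ k)) (trans (recip-inverse x x≢0) (sym inv)) ⟩
      v * s k - (cs k * rc k) * (v * cs k * q) ≡⟨ cong₂ (λ a b → v * a - b * (v * cs k * q)) (trans (sym (*-identityʳ (s k))) (cong (s k *_) (sym inv))) inv ⟩
      v * (s k * (cs k * rc k)) - 1ℚ * (v * cs k * q)
                                           ≡⟨ solve 5 (λ v s c r q → v :* (s :* (c :* r)) :- con 1ℚ :* (v :* c :* q) := (v :* c) :* (s :* r :- q))
                                                refl v (s k) (cs k) (rc k) q ⟩
      (v * cs k) * t k                     ∎
      where
      open ≡-Reasoning
      open +-*-Solver
      i = recip x

    recover : ∀ k → cs k * rc k ≡ 1ℚ → recip x * (v * (cs k * t k)) ≡ z k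
    recover k inv = *-cancelˡ-≡ x≢0 (begin
      x * (recip x * (v * (cs k * t k)))   ≡⟨ solve 5 (λ x i v c t → x :* (i :* (v :* (c :* t))) := (x :* i) :* ((v :* c) :* t)) refl x (recip x) v (cs k) (t k) ⟩
      (x * recip x) * ((v * cs k) * t k)   ≡⟨ cong (_* ((v * cs k) * t k)) (recip-inverse x x≢0) ⟩
      1ℚ * ((v * cs k) * t k)              ≡⟨ *-identityˡ ((v * cs k) * t k) ⟩
      (v * cs k) * t k                     ≡⟨ xz k inv ⟨
      x * z k                              ∎)
      where
      open ≡-Reasoning
      open +-*-Solver

    invertible : Eventually (λ k → cs k * rc k ≡ 1ℚ)
    invertible = eventually₁
      (λ k far → recip-inverse (cs k) λ cs≡0 →
        <-irrefl refl (<-≤-trans (proj₁ (proj₂ cos-away)) (subst (λ w → proj₁ cos-away ≤ ∣ w ∣) cs≡0 far)))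
      (proj₂ (proj₂ cos-away))

    c*t-null : Null (λ k → cs k * t k)
    c*t-null = choose (bounded cs (cauchy (cos (fromℚ x))))
      where
      choose : ∃[ M ] ∃[ N ] (1 ℕ.≤ M × (∀ n → N ℕ.≤ n → ∣ cs n ∣ ≤ ν M)) → Null (λ k → cs k * t k)
      choose (M , N , _ , bound) = null-bounded-* {t} {cs} (ν M) (0≤ν M) (N , bound) tan≃q

    z-null : Null z
    z-null = null-cong {λ k → recip x * (v * (cs k * t k))} {z}
      (eventually₁ recover invertible)
      (null-* {λ k → v * (cs k * t k)} (recip x) (null-* {λ k → cs k * t k} v c*t-null))

theorem1 : (r : ℚ) → r ≢ 0ℚ →
    Σ[ cosr#0 ∈ cos (fromℚ r) #0 ] Irrational (tan (fromℚ r) cosr#0)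
theorem1 r r≢0 = cos-away , tan-irrational
  where open Lambert r r≢0
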